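{- Let $q_0\ge 2$ be even, let $s\ge 2$ and $q=q_0^s$. Then $\rho(C_s(q_0))=3$ if and only if there exists $\alpha\in\mathbb{F}_q\setminus\mathbb{F}_{q_0}$ such that (1) $\mathrm{Tr}_{\mathbb{F}_q/\mathbb{F}_{q_0}}(\alpha)=0$, and (2) $\mathrm{Tr}_{\mathbb{F}_q/\mathbb{F}_{q_0}}\left(\frac{1}{1+b\alpha}\right)\in\{0,1\}$ for all $b\in\mathbb{F}_{q_0}^*$. Otherwise $\rho(C_s(q_0))=2$.
   Context: Let $q_0$ be a prime power, $s\ge1$, $q=q_0^s$, and $H=\{x\in\mathbb{F}_{q^2}: x^{q+1}=1\}$. The code $C_s(q_0)$ is the linear code of length $q+1$ over $\mathbb{F}_{q_0}$ with coordinates indexed by $H$: $C_s(q_0)=\{(c_x)_{x\in H}\in\mathbb{F}_{q_0}^{q+1}: \sum_{x\in H}c_x x=0\}$. $\rho(C)$ denotes the covering radius of a code $C$ (maximum over all vectors of the minimum Hamming distance to the code). $\mathrm{Tr}_{\mathbb{F}_q/\mathbb{F}_{q_0}}(y)=\sum_{i=0}^{s-1}y^{q_0^i}$ is the relative trace. -}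

module Defs where

open import Level using (Level; _⊔_) renaming (suc to lsuc)
open import Data.Nat using (ℕ; zero; suc; _≤_) renaming (_^_ to _^ℕ_)
open import Data.Fin using (Fin)
open import Data.List using (List; length; filter; foldr; map; allFin; lookup)
open import Data.Product using (_×_; ∃; ∃-syntax)
open import Data.Sum using (_⊎_)
open import Relation.Nullary using (¬_; ¬?)
open import Relation.Binary using (Decidable)
open import Algebra.Bundles using (CommutativeRing)
open import Data.List.Membership.Setoid using (_∈_)
open import Data.List.Relation.Unary.Unique.Setoid using (Unique)

-- A finite field: a commutative ring with decidable equality, 1 ≠ 0,
-- multiplicative inverses of nonzero elements (total operation _⁻¹,
-- value at 0 irrelevant), and a duplicate-free complete enumeration.
record FiniteField (c ℓ : Level) : Set (lsuc (c ⊔ ℓ)) where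
  field
    commRing : CommutativeRing c ℓ
  open CommutativeRing commRing public hiding (ring)
  field
    _≟_       : Decidable _≈_
    1≉0       : ¬ (1# ≈ 0#)
    _⁻¹       : Carrier → Carrier
    inverseʳ  : ∀ x → ¬ (x ≈ 0#) → (x * (x ⁻¹)) ≈ 1#
    elems     : List Carrier
    complete  : ∀ x → _∈_ setoid x elems
    unique    : Unique setoid elems

  card : ℕ
  card = length elems

module _ {c ℓ : Level} (K : FiniteField c ℓ) where
  open FiniteField K

  pow : Carrier → ℕ → Carrier
  pow x zero    = 1#
  pow x (suc n) = x * pow x n

  -- x lies in the subfield F_Q = { x : x^Q = x }
  InSub : ℕ → Carrier → Set ℓ
  InSub Q x = pow x Q ≈ x

  Tr : ℕ → ℕ → Carrier → Carrier
  Tr q0 zero    y = 0#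
  Tr q0 (suc i) y = Tr q0 i y + pow y (q0 ^ℕ i)

  Hlist : ℕ → List Carrier
  Hlist q = filter (λ x → pow x (suc q) ≟ 1#) elems

  Word : ℕ → Set c
  Word q = Fin (length (Hlist q)) → Carrier

  IsWord : ℕ → (q : ℕ) → Word q → Set ℓ
  IsWord q0 q w = ∀ i → InSub q0 (w i)

  synd : (q : ℕ) → Word q → Carrier
  synd q w = foldr _+_ 0# (map (λ i → w i * lookup (Hlist q) i) (allFin (length (Hlist q))))

  InCode : ℕ → (q : ℕ) → Word q → Set ℓ
  InCode q0 q w = IsWord q0 q w × synd q w ≈ 0#

  dist : (q : ℕ) → Word q → Word q → ℕ
  dist q u v = length (filter (λ i → ¬? (u i ≟ v i)) (allFin (length (Hlist q))))

  CoveringRadiusIs : ℕ → ℕ → ℕ → Set (c ⊔ ℓ)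
  CoveringRadiusIs q0 q r =
    (∀ v → IsWord q0 q v → ∃[ w ] (InCode q0 q w × dist q v w ≤ r)) ×
    (∃[ v ] (IsWord q0 q v × (∀ w → InCode q0 q w → r ≤ dist q v w)))

  Cond : ℕ → ℕ → Set (c ⊔ ℓ)
  Cond q0 s = ∃[ α ] (InSub (q0 ^ℕ s) α × ¬ InSub q0 α × Tr q0 s α ≈ 0# ×
     (∀ b → InSub q0 b → ¬ (b ≈ 0#) →
        (Tr q0 s ((1# + b * α) ⁻¹) ≈ 0#) ⊎ (Tr q0 s ((1# + b * α) ⁻¹) ≈ 1#)))

{-# OPTIONS --safe #-}
-- Let a syndrome z be a sum of k terms a t with a ∈ 𝔽_{q₀} and t ∈ H. Every z ≠ 0 is h y with
-- h ∈ H and y ∈ 𝔽_q, so only y ∈ 𝔽_q matters, and one term suffices exactly when y ∈ 𝔽_{q₀}.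
-- Otherwise, taking norms, y is a sum of two terms iff y² = a² + b² + a b (t + t⁻¹) for some
-- a, b ∈ 𝔽_{q₀}, t ∈ H. The values t + t⁻¹ ≠ 0 are the reciprocals of the w ∈ 𝔽_q with absolute
-- trace 1, and with c = a + b the absolute trace of a b/(y + c)² is that of a Tr(y/(y + c)²). So y
-- needs three terms iff Tr(y/(y + c)²) = 0 for all c ∈ 𝔽_{q₀}, which is the stated condition on
-- α = 1/y. An injection that would miss 0 shows that three points of H always suffice.
module Submission where

open import Defs
open import Level using (Level; _⊔_; Lift; lift)
open import Algebra.Bundles using (CommutativeRing; CommutativeMonoid)
import Algebra.Solver.Ring as RingSolver
import Algebra.Solver.Ring.AlmostCommutativeRing as ACR
open import Data.Bool using (Bool; true; false)
open import Data.Bool.Properties using (xor-∧-commutativeRing)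
open import Data.Fin as Fin using (Fin; zero; suc)
import Data.Fin.Properties as Fin
open import Data.List using (List; []; _∷_; _++_; map; foldr; filter; length; tabulate;
  lookup; allFin)
open import Data.List.Properties using (length-map; length-++; map-tabulate; filter-none)
open import Data.List.Membership.Setoid using (find; lose)
open import Data.List.Membership.Setoid.Properties
  using (∈-∃++; ∈-resp-≈; ∈-map⁻; ∈-lookup; ∈-filter⁺; ∈-filter⁻)
import Data.List.Relation.Binary.Permutation.Setoid as Permutation
import Data.List.Relation.Binary.Permutation.Setoid.Properties as Permutationₚ
open import Data.List.Relation.Unary.All as All using (All; []; _∷_)
import Data.List.Relation.Unary.All.Properties as All
open import Data.List.Relation.Unary.AllPairs using ([]; _∷_)
open import Data.List.Relation.Unary.Any as Any using (here; there)
import Data.List.Relation.Unary.Any.Properties as Any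
open import Data.List.Relation.Unary.Unique.Setoid using (Unique)
import Data.List.Relation.Unary.Unique.Setoid.Properties as Unique
open import Data.Maybe using (just; nothing)
open import Data.Nat as ℕ using (ℕ; zero; suc; _≤_; _<_; z≤n; s≤s; _^_)
import Data.Nat.Properties as ℕ
open import Data.Product using (_×_; _,_; ∃; ∃-syntax; proj₁; proj₂)
open import Data.Sum using (_⊎_; inj₁; inj₂; [_,_]′)
open import Function using (_∘_; id)
open import Function.Bundles using (_⇔_; mk⇔)
open import Relation.Binary using (Setoid)
open import Relation.Binary.Definitions using (WeaklyDecidable)
open import Relation.Binary.PropositionalEquality as ≡ using (_≡_)
open import Relation.Nullary using (¬_; Dec; yes; no; contradiction; ¬?)
open import Relation.Nullary.Decidable using (_×-dec_; map′; decidable-stable)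
open import Relation.Unary using (Pred; Decidable)

-- Two terms involve unknown coefficients and an unknown point; the absolute trace eliminates all
-- but one. A suitable point exists iff some element has absolute trace 1. That element is quadratic
-- in `a`, but squaring keeps the absolute trace, so its trace is that of a γ, where γ is the
-- relative trace. If γ ≠ 0, then a γ takes every value in 𝔽_{q₀}, one of which has absolute trace
-- 1; if γ = 0, no `a` works. Only the sum c of the two coefficients remains as a parameter. For c ≠
-- 0, c γ = Tr(β)² + Tr(β) with β = 1/(1 + c α), hence the values 0 and 1 in condition (2); c = 0
-- gives condition (1). For three terms all coefficients can be 1. With t, t′ ≠ 1 in H, the norms of
-- y + t and those of 1 + t′ form two sets of q/2 nonzero elements of 𝔽_q. They cannot be disjoint
-- among q - 1 elements: this is the count behind the injection.

module UniqueLists {a ℓ} (S : Setoid a ℓ) where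
  open Setoid S
  open Permutation S hiding (refl; trans)
  open Permutationₚ S
  open import Data.List.Membership.Setoid S using (_∈_)

  -- Each element of `xs` is removed from `ys` in turn; uniqueness keeps the later ones in what is
  -- left. The surplus `zs` gives the length inequality, and it must be empty when `ys` is no longer
  -- than `xs`.
  unique⇒↭++ : ∀ {xs ys} → Unique S xs → (∀ {x} → x ∈ xs → x ∈ ys) →
               ∃[ zs ] ys ↭ xs ++ zs
  unique⇒↭++ {[]}     {ys} _           _     = ys , ↭-refl
  unique⇒↭++ {x ∷ xs} {ys} (x∉ ∷ xs!) xs⊆ys =
    let as , bs , v , x≈v , ys≋ = ∈-∃++ S (xs⊆ys (here refl))
        ys↭ : ys ↭ x ∷ as ++ bs
        ys↭ = ↭-trans (↭-reflexive-≋ ys≋) (shift (sym x≈v) as bs)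
        rest : ∀ {z} → z ∈ xs → z ∈ as ++ bs
        rest {z} z∈xs = drop z∈xs (∈-resp-↭ ys↭ (xs⊆ys (there z∈xs)))
        zs , as++bs↭ = unique⇒↭++ xs! rest
    in zs , ↭-trans ys↭ (↭-prep x as++bs↭)
    where
    drop : ∀ {z ws} → z ∈ xs → z ∈ x ∷ ws → z ∈ ws
    drop z∈xs (here z≈x) = contradiction (∈-resp-≈ S z≈x z∈xs) (All.All¬⇒¬Any x∉)
    drop z∈xs (there z∈) = z∈

  unique⇒length≤ : ∀ {xs ys} → Unique S xs → (∀ {x} → x ∈ xs → x ∈ ys) →
                   length xs ≤ length ys
  unique⇒length≤ {xs} xs! xs⊆ys =
    let zs , ys↭ = unique⇒↭++ xs! xs⊆ys
    in ℕ.≤-trans (ℕ.m≤m+n (length xs) (length zs))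
         (ℕ.≤-reflexive (≡.trans (≡.sym (length-++ xs)) (≡.sym (xs↭ys⇒|xs|≡|ys| ys↭))))

  unique⇒↭ : ∀ {xs ys} → Unique S xs → (∀ {x} → x ∈ xs → x ∈ ys) →
             length ys ≤ length xs → ys ↭ xs
  unique⇒↭ {xs} {ys} xs! xs⊆ys len with unique⇒↭++ xs! xs⊆ys
  ... | [] , ys↭ = ↭-trans ys↭ (++-identityʳ xs)
  ... | z ∷ zs , ys↭ = contradiction len (ℕ.<⇒≱ (ℕ.<-≤-trans
          (ℕ.m<m+n (length xs) (s≤s z≤n))
          (ℕ.≤-reflexive (≡.trans (≡.sym (length-++ xs)) (≡.sym (xs↭ys⇒|xs|≡|ys| ys↭))))))

-- Finite fields: permutations of the elements, Fermat's theorem, roots of polynomials.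

module FieldFacts {c ℓ} (K : FiniteField c ℓ) where
  open FiniteField K public hiding (zero)
  open import Relation.Binary.Reasoning.Setoid setoid public
  open import Algebra.Properties.AbelianGroup +-abelianGroup public
    using () renaming (∙-cancelˡ to +-cancelˡ; ∙-cancelʳ to +-cancelʳ)
  open import Algebra.Properties.CommutativeSemigroup *-commutativeSemigroup public
    using () renaming (interchange to *-interchange; x∙yz≈y∙xz to x*yz≈y*xz)
  open import Algebra.Properties.CommutativeSemigroup
    (CommutativeMonoid.commutativeSemigroup +-commutativeMonoid) public
    using () renaming (interchange to +-interchange)
  open import Data.List.Membership.Setoid setoid public using (_∈_)
  private
    module P  = Permutation setoid
    module PP = Permutationₚ setoid
  open UniqueLists setoid

  infixr 8 _^^_
  _^^_ : Carrier → ℕ → Carrier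
  x ^^ n = pow K x n

  inverseˡ : ∀ {x} → ¬ x ≈ 0# → x ⁻¹ * x ≈ 1#
  inverseˡ x≉0 = trans (*-comm _ _) (inverseʳ _ x≉0)

  *-cancelˡ : ∀ {x y z} → ¬ x ≈ 0# → x * y ≈ x * z → y ≈ z
  *-cancelˡ {x} {y} {z} x≉0 eq = trans (sym (lemma y)) (trans (*-congˡ eq) (lemma z))
    where
    lemma : ∀ w → x ⁻¹ * (x * w) ≈ w
    lemma w = trans (sym (*-assoc _ _ _)) (trans (*-congʳ (inverseˡ x≉0)) (*-identityˡ w))

  *-≉0 : ∀ {x y} → ¬ x ≈ 0# → ¬ y ≈ 0# → ¬ x * y ≈ 0#
  *-≉0 x≉0 y≉0 xy≈0 = y≉0 (*-cancelˡ x≉0 (trans xy≈0 (sym (zeroʳ _))))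

  ⁻¹-≉0 : ∀ {x} → ¬ x ≈ 0# → ¬ x ⁻¹ ≈ 0#
  ⁻¹-≉0 {x} x≉0 eq = 1≉0 (trans (sym (inverseʳ x x≉0)) (trans (*-congˡ eq) (zeroʳ x)))

  pow-cong : ∀ n {x y} → x ≈ y → x ^^ n ≈ y ^^ n
  pow-cong zero    eq = refl
  pow-cong (suc n) eq = *-cong eq (pow-cong n eq)

  pow-* : ∀ n x y → (x * y) ^^ n ≈ x ^^ n * y ^^ n
  pow-* zero    x y = sym (*-identityˡ 1#)
  pow-* (suc n) x y = trans (*-congˡ (pow-* n x y)) (*-interchange x y _ _)

  pow-+ : ∀ m n x → x ^^ (m ℕ.+ n) ≈ x ^^ m * x ^^ n
  pow-+ zero    n x = sym (*-identityˡ _)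
  pow-+ (suc m) n x = trans (*-congˡ (pow-+ m n x)) (sym (*-assoc _ _ _))

  pow-1# : ∀ n → 1# ^^ n ≈ 1#
  pow-1# zero    = refl
  pow-1# (suc n) = trans (*-identityˡ _) (pow-1# n)

  pow-∘ : ∀ m n x → x ^^ (n ℕ.* m) ≈ (x ^^ m) ^^ n
  pow-∘ m zero    x = refl
  pow-∘ m (suc n) x = trans (pow-+ m (n ℕ.* m) x) (*-congˡ (pow-∘ m n x))

  pow-≉0 : ∀ n {x} → ¬ x ≈ 0# → ¬ x ^^ n ≈ 0#
  pow-≉0 zero    x≉0 = 1≉0
  pow-≉0 (suc n) x≉0 = *-≉0 x≉0 (pow-≉0 n x≉0)

  -- The image list is duplicate-free and as long as `elems`. Sums over the field are therefore
  -- invariant under injective maps, and injective maps are onto.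
  injective⇒↭ : (f : Carrier → Carrier) → (∀ {x y} → f x ≈ f y → x ≈ y) →
                elems P.↭ map f elems
  injective⇒↭ f inj = unique⇒↭ (Unique.map⁺ setoid setoid inj unique) (λ _ → complete _)
    (ℕ.≤-reflexive (≡.sym (length-map f elems)))

  injective⇒surjective : (f : Carrier → Carrier) → (∀ {x y} → f x ≈ f y → x ≈ y) →
                         ∀ y → ∃[ x ] y ≈ f x
  injective⇒surjective f inj y =
    let x , _ , y≈fx = ∈-map⁻ setoid setoid (PP.∈-resp-↭ (injective⇒↭ f inj) (complete y))
    in x , y≈fx

  _·1 : ℕ → Carrier
  zero  ·1 = 0#
  suc n ·1 = 1# + n ·1

  +-·1 : ∀ m n → (m ℕ.+ n) ·1 ≈ m ·1 + n ·1
  +-·1 zero    n = sym (+-identityˡ _)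
  +-·1 (suc m) n = trans (+-congˡ (+-·1 m n)) (sym (+-assoc _ _ _))

  *-·1 : ∀ m n → (m ℕ.* n) ·1 ≈ m ·1 * n ·1
  *-·1 zero    n = sym (zeroˡ _)
  *-·1 (suc m) n = trans (+-·1 n (m ℕ.* n)) (trans
    (+-cong (sym (*-identityˡ _)) (*-·1 m n)) (sym (distribʳ _ _ _)))

  -- The sum of all elements is unchanged when every element is increased by 1.
  card·1≈0 : card ·1 ≈ 0#
  card·1≈0 = +-cancelʳ (Σ elems) _ _ (begin
    card ·1 + Σ elems       ≈⟨ shifted elems ⟨
    Σ (map (1# +_) elems)   ≈⟨ PP.foldr-commMonoid +-isCommutativeMonoid
                                 (injective⇒↭ (1# +_) (+-cancelˡ 1# _ _)) ⟨
    Σ elems                 ≈⟨ +-identityˡ _ ⟨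
    0# + Σ elems            ∎)
    where
    Σ : List Carrier → Carrier
    Σ = foldr _+_ 0#
    shifted : ∀ xs → Σ (map (1# +_) xs) ≈ length xs ·1 + Σ xs
    shifted []       = sym (+-identityˡ 0#)
    shifted (x ∷ xs) = trans (+-congˡ (shifted xs)) (+-interchange 1# x _ _)

  -- Without zero divisors, a nonzero `1# + 1#` would have only nonzero powers.
  2^n·1≈0⇒char2 : ∀ n → (2 ^ n) ·1 ≈ 0# → 1# + 1# ≈ 0#
  2^n·1≈0⇒char2 n eq with (1# + 1#) ≟ 0#
  ... | yes 2≈0 = 2≈0
  ... | no  2≉0 = contradiction eq (2^-≉0 n)
    where
    2^-≉0 : ∀ n → ¬ (2 ^ n) ·1 ≈ 0#
    2^-≉0 zero    eq = 1≉0 (trans (sym (+-identityʳ 1#)) eq)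
    2^-≉0 (suc n) eq = *-≉0 (λ e → 2≉0 (trans (+-congˡ (sym (+-identityʳ 1#))) e)) (2^-≉0 n)
      (trans (sym (*-·1 2 (2 ^ n))) eq)

  private
    nonzero? : ∀ x → Dec (¬ x ≈ 0#)
    nonzero? x = ¬? (x ≟ 0#)

    nonzero-resp : ∀ {x y} → x ≈ y → ¬ x ≈ 0# → ¬ y ≈ 0#
    nonzero-resp x≈y x≉0 y≈0 = x≉0 (trans x≈y y≈0)

    units : List Carrier
    units = filter nonzero? elems

    ∈units : ∀ {x} → ¬ x ≈ 0# → x ∈ units
    ∈units x≉0 = ∈-filter⁺ setoid nonzero? nonzero-resp (complete _) x≉0

    units⇒≉0 : ∀ {x} → x ∈ units → ¬ x ≈ 0#
    units⇒≉0 {x} x∈ = proj₂ (∈-filter⁻ setoid nonzero? nonzero-resp {v = x} {xs = elems} x∈)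

    units! : Unique setoid units
    units! = Unique.filter⁺ setoid nonzero? unique

    0∷units! : Unique setoid (0# ∷ units)
    0∷units! = All.tabulateₛ setoid (λ {x} x∈ 0≈x → units⇒≉0 x∈ (sym 0≈x)) ∷ units!

    card≡ : card ≡ suc (length units)
    card≡ = PP.xs↭ys⇒|xs|≡|ys| (unique⇒↭ 0∷units! (λ _ → complete _)
              (unique⇒length≤ unique λ {x} _ → in0∷ x))
      where
      in0∷ : ∀ x → x ∈ 0# ∷ units
      in0∷ x with x ≟ 0#
      ... | yes x≈0 = here x≈0
      ... | no  x≉0 = there (∈units x≉0)

    Π : List Carrier → Carrier
    Π = foldr _*_ 1#

    Π-scale : ∀ a xs → Π (map (a *_) xs) ≈ a ^^ length xs * Π xs
    Π-scale a []       = sym (*-identityˡ 1#)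
    Π-scale a (x ∷ xs) = trans (*-congˡ (Π-scale a xs)) (*-interchange a x _ _)

    Π-≉0 : ∀ {xs} → All (λ x → ¬ x ≈ 0#) xs → ¬ Π xs ≈ 0#
    Π-≉0 []           = 1≉0
    Π-≉0 (x≉0 ∷ rest) = *-≉0 x≉0 (Π-≉0 rest)

    -- Multiplication by `a` permutes the nonzero elements, so their product stays the same while it
    -- gains one factor `a` for each of them.
    units-order : ∀ {a} → ¬ a ≈ 0# → a ^^ length units ≈ 1#
    units-order {a} a≉0 = *-cancelˡ (Π-≉0 (All.tabulateₛ setoid units⇒≉0)) (begin
      Π units * a ^^ length units ≈⟨ *-comm _ _ ⟩
      a ^^ length units * Π units ≈⟨ Π-scale a units ⟨
      Π (map (a *_) units)        ≈⟨ PP.foldr-commMonoid *-isCommutativeMonoid scaled ⟩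
      Π units                     ≈⟨ *-identityʳ _ ⟨
      Π units * 1#                ∎)
      where
      scaled : map (a *_) units P.↭ units
      scaled = P.↭-sym (unique⇒↭ (Unique.map⁺ setoid setoid (*-cancelˡ a≉0) units!)
        (λ x∈ → let y , y∈ , x≈ay = ∈-map⁻ setoid setoid x∈
                in ∈units (nonzero-resp (sym x≈ay) (*-≉0 a≉0 (units⇒≉0 y∈))))
        (ℕ.≤-reflexive (≡.sym (length-map _ units))))

  pow-card : ∀ x → x ^^ card ≈ x
  pow-card x rewrite card≡ with x ≟ 0#
  ... | yes x≈0 = trans (*-congʳ x≈0) (trans (zeroˡ _) (sym x≈0))
  ... | no  x≉0 = trans (*-congˡ (units-order x≉0)) (*-identityʳ x)

  -- IsPoly d a f: f is a polynomial function of formal degree d whose coefficient at x^d is a.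
  IsPoly : ℕ → Carrier → (Carrier → Carrier) → Set (c ⊔ ℓ)
  IsPoly zero    a f = ∀ x → f x ≈ a
  IsPoly (suc d) a f = ∃[ a₀ ] ∃[ g ] IsPoly d a g × (∀ x → f x ≈ a₀ + x * g x)

  poly-cong : ∀ d {a b f} → a ≈ b → IsPoly d a f → IsPoly d b f
  poly-cong zero    a≈b p                = λ x → trans (p x) a≈b
  poly-cong (suc d) a≈b (a₀ , g , p , e) = a₀ , g , poly-cong d a≈b p , e

  poly-+ : ∀ d {a b f g} → IsPoly d a f → IsPoly d b g → IsPoly d (a + b) (λ x → f x + g x)
  poly-+ zero    p q = λ x → +-cong (p x) (q x)
  poly-+ (suc d) (a₀ , f , p , e) (b₀ , g , q , e′) =
    a₀ + b₀ , _ , poly-+ d p q , λ x →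
      trans (+-cong (e x) (e′ x)) (trans (+-interchange _ _ _ _) (+-congˡ (sym (distribˡ x _ _))))

  -- Degrees are formal: a zero leading coefficient brings a summand to the common degree that
  -- `poly-+` asks for.
  poly-raise : ∀ d {a f} → IsPoly d a f → IsPoly (suc d) 0# f
  poly-raise zero    {a} p = a , (λ _ → 0#) , (λ _ → refl) ,
    λ x → trans (p x) (sym (trans (+-congˡ (zeroʳ x)) (+-identityʳ a)))
  poly-raise (suc d) (a₀ , g , p , e) = a₀ , g , poly-raise d p , e

  poly-raise-< : ∀ {d d′ a f} → d < d′ → IsPoly d a f → IsPoly d′ 0# f
  poly-raise-< {d} {suc d′} (s≤s d≤d′) p with ℕ.m≤n⇒m<n∨m≡n d≤d′
  ... | inj₁ d<d′   = poly-raise d′ (poly-raise-< d<d′ p)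
  ... | inj₂ ≡.refl = poly-raise d p

  poly-pow : ∀ d → IsPoly d 1# (_^^ d)
  poly-pow zero    = λ _ → refl
  poly-pow (suc d) = 0# , (_^^ d) , poly-pow d , λ x → sym (+-identityˡ _)

  private
    split : ∀ x r → x ≈ r + (x + - r)
    split x r = sym (trans (+-comm _ _) (trans (+-assoc _ _ _)
      (trans (+-congˡ (-‿inverseˡ r)) (+-identityʳ x))))

  -- Synthetic division: if h is the quotient of g by x - r, then g r + x h is the quotient of a₀ +
  -- x g.
  poly-factor : ∀ d {a f} → IsPoly (suc d) a f → ∀ r →
                ∃[ g ] IsPoly d a g × (∀ x → f x ≈ f r + (x + - r) * g x)
  poly-factor zero {a} {f} (a₀ , g , p , e) r = (λ _ → a) , (λ _ → refl) , λ x → begin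
      f x                               ≈⟨ e x ⟩
      a₀ + x * g x                      ≈⟨ +-congˡ (*-congˡ (p x)) ⟩
      a₀ + x * a                        ≈⟨ +-congˡ (*-congʳ (split x r)) ⟩
      a₀ + (r + (x + - r)) * a          ≈⟨ +-congˡ (distribʳ _ _ _) ⟩
      a₀ + (r * a + (x + - r) * a)      ≈⟨ +-assoc _ _ _ ⟨
      (a₀ + r * a) + (x + - r) * a      ≈⟨ +-congʳ (trans (e r) (+-congˡ (*-congˡ (p r)))) ⟨
      f r + (x + - r) * a               ∎
  poly-factor (suc d) {a} {f} (a₀ , g , p , e) r =
    let h , q , e′ = poly-factor d p r in
    (λ x → g r + x * h x) , (g r , h , q , λ _ → refl) , λ x → begin
      f x                                                     ≈⟨ e x ⟩
      a₀ + x * g x                                            ≈⟨ +-congˡ (*-congˡ (e′ x)) ⟩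
      a₀ + x * (g r + (x + - r) * h x)                        ≈⟨ +-congˡ (distribˡ _ _ _) ⟩
      a₀ + (x * g r + x * ((x + - r) * h x))                  
        ≈⟨ +-congˡ (+-cong (*-congʳ (split x r)) (x*yz≈y*xz _ _ _)) ⟩
      a₀ + ((r + (x + - r)) * g r + (x + - r) * (x * h x))    ≈⟨ +-congˡ (+-congʳ (distribʳ _ _ _)) ⟩
      a₀ + ((r * g r + (x + - r) * g r) + (x + - r) * (x * h x)) ≈⟨ +-congˡ (+-assoc _ _ _) ⟩
      a₀ + (r * g r + ((x + - r) * g r + (x + - r) * (x * h x))) ≈⟨ +-assoc _ _ _ ⟨
      (a₀ + r * g r) + ((x + - r) * g r + (x + - r) * (x * h x))
        ≈⟨ +-cong (sym (e r)) (sym (distribˡ _ _ _)) ⟩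
      f r + (x + - r) * (g r + x * h x)                       ∎

  roots≤degree : ∀ d {a f} → IsPoly d a f → ¬ a ≈ 0# → ∀ {xs} → Unique setoid xs →
                 All (λ x → f x ≈ 0#) xs → length xs ≤ d
  roots≤degree d       p a≉0 []         []       = z≤n
  roots≤degree zero    p a≉0 (_ ∷ _)    (e ∷ _)  = contradiction (trans (sym (p _)) e) a≉0
  roots≤degree (suc d) {f = f} p a≉0 {r ∷ xs} (r∉ ∷ xs!) (fr≈0 ∷ es) =
    let g , q , e = poly-factor d p r
        root : ∀ {x} → (¬ r ≈ x) × f x ≈ 0# → g x ≈ 0#
        root {x} (r≉x , fx≈0) = *-cancelˡ
          (λ x-r≈0 → r≉x (sym (+-cancelʳ (- r) x r (trans x-r≈0 (sym (-‿inverseʳ r))))))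
          (begin
            (x + - r) * g x       ≈⟨ +-identityˡ _ ⟨
            0# + (x + - r) * g x  ≈⟨ +-congʳ fr≈0 ⟨
            f r + (x + - r) * g x ≈⟨ e x ⟨
            f x                   ≈⟨ fx≈0 ⟩
            0#                    ≈⟨ zeroʳ _ ⟨
            (x + - r) * 0#        ∎)
    in s≤s (roots≤degree d q a≉0 xs! (All.zipWith root (r∉ , es)))

  nonroot : ∀ d {a f} → IsPoly d a f → ¬ a ≈ 0# → d < card → ∃[ x ] ¬ f x ≈ 0#
  nonroot d {f = f} p a≉0 d<card with All.all? (λ x → f x ≟ 0#) elems
  ... | yes all0 = contradiction (roots≤degree d p a≉0 unique all0) (ℕ.<⇒≱ d<card)
  ... | no ¬all0 = Any.satisfied (All.¬All⇒Any¬ (λ x → f x ≟ 0#) elems ¬all0)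

-- Characteristic 2: Frobenius powers, traces and Artin-Schreier equations.

Characteristic2 : ∀ {c ℓ} → FiniteField c ℓ → Set ℓ
Characteristic2 K = 1# + 1# ≈ 0#
  where open FiniteField K

module Char2 {c ℓ} (K : FiniteField c ℓ)
  (1+1≈0 : Characteristic2 K)
  where
  open FieldFacts K public

  x+x≈0 : ∀ x → x + x ≈ 0#
  x+x≈0 x = begin
    x + x             ≈⟨ +-cong (*-identityˡ x) (*-identityˡ x) ⟨
    1# * x + 1# * x   ≈⟨ distribʳ x 1# 1# ⟨
    (1# + 1#) * x     ≈⟨ *-congʳ 1+1≈0 ⟩
    0# * x            ≈⟨ zeroˡ x ⟩
    0#                ∎

  -x≈x : ∀ x → - x ≈ x
  -x≈x x = +-cancelˡ x _ _ (trans (-‿inverseʳ x) (sym (x+x≈0 x)))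

  -- Taking coefficients in 𝔽₂ makes the solver decide identities of characteristic 2.
  private
    embed : Bool → Carrier
    embed false = 0#
    embed true  = 1#

    almost : ACR.AlmostCommutativeRing c ℓ
    almost = ACR.fromCommutativeRing commRing

    embed-morphism : ACR._-Raw-AlmostCommutative⟶_
      (CommutativeRing.rawRing xor-∧-commutativeRing) almost
    embed-morphism = record
      { ⟦_⟧    = embed
      ; +-homo = λ { false b     → sym (+-identityˡ _)
                   ; true  false → sym (+-identityʳ _)
                   ; true  true  → sym 1+1≈0 }
      ; *-homo = λ { false b → sym (zeroˡ _) ; true b → sym (*-identityˡ _) }
      ; -‿homo = λ b → sym (-x≈x _)
      ; 0-homo = refl
      ; 1-homo = refl
      }

    coefficient-≟ : WeaklyDecidable (ACR.Induced-equivalence embed-morphism)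
    coefficient-≟ false false = just refl
    coefficient-≟ true  true  = just refl
    coefficient-≟ _     _     = nothing

  open RingSolver (CommutativeRing.rawRing xor-∧-commutativeRing) almost
    embed-morphism coefficient-≟ public
    using (solve; _:=_; _:+_; _:*_; con; Polynomial)

  :1 :0 : ∀ {n} → Polynomial n
  :1 = con true
  :0 = con false

  x+y≈0⇒x≈y : ∀ {x y} → x + y ≈ 0# → x ≈ y
  x+y≈0⇒x≈y {x} {y} eq = +-cancelʳ y x y (trans eq (sym (x+x≈0 y)))

  x≈y⇒x+y≈0 : ∀ {x y} → x ≈ y → x + y ≈ 0#
  x≈y⇒x+y≈0 {x} {y} eq = trans (+-congʳ eq) (x+x≈0 y)

  -- The equations l ≈ r that follow from p ≈ p′ (and q ≈ q′): exhibit l + r as a combination.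
  by₁ : ∀ {l r p p′} k → p ≈ p′ → l + r ≈ k * (p + p′) → l ≈ r
  by₁ k p≈ eq = x+y≈0⇒x≈y (trans eq (trans (*-congˡ (x≈y⇒x+y≈0 p≈)) (zeroʳ k)))

  by₂ : ∀ {l r p p′ q q′} k₁ k₂ → p ≈ p′ → q ≈ q′ →
        l + r ≈ k₁ * (p + p′) + k₂ * (q + q′) → l ≈ r
  by₂ k₁ k₂ p≈ q≈ eq = x+y≈0⇒x≈y (trans eq (trans
    (+-cong (trans (*-congˡ (x≈y⇒x+y≈0 p≈)) (zeroʳ k₁)) (trans (*-congˡ (x≈y⇒x+y≈0 q≈)) (zeroʳ k₂)))
    (+-identityʳ 0#)))

  sq-injective : ∀ {x y} → x * x ≈ y * y → x ≈ y
  sq-injective {x} {y} eq with (x + y) ≟ 0#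
  ... | yes x+y≈0 = x+y≈0⇒x≈y x+y≈0
  ... | no  x+y≉0 = contradiction
    (by₁ 1# eq (solve 2 (λ x y → (x :+ y) :* (x :+ y) :+ :0 := :1 :* (x :* x :+ y :* y)) refl x y))
    (*-≉0 x+y≉0 x+y≉0)

  F : ℕ → Carrier → Carrier
  F k x = x ^^ (2 ^ k)

  F-cong : ∀ k {x y} → x ≈ y → F k x ≈ F k y
  F-cong k = pow-cong (2 ^ k)

  F-≡ : ∀ {j k} x → j ≡ k → F j x ≈ F k x
  F-≡ x ≡.refl = refl

  F-zero : ∀ x → F 0 x ≈ x
  F-zero x = *-identityʳ x

  F-∘ : ∀ j k x → F (j ℕ.+ k) x ≈ F j (F k x)
  F-∘ j k x rewrite ℕ.^-distribˡ-+-* 2 j k = pow-∘ (2 ^ k) (2 ^ j) x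

  F-comm : ∀ j k x → F j (F k x) ≈ F k (F j x)
  F-comm j k x = trans (sym (F-∘ j k x)) (trans (F-≡ x (ℕ.+-comm j k)) (F-∘ k j x))

  F-sq : ∀ k x → F (suc k) x ≈ F k x * F k x
  F-sq k x rewrite ℕ.+-identityʳ (2 ^ k) = pow-+ (2 ^ k) (2 ^ k) x

  F-* : ∀ k x y → F k (x * y) ≈ F k x * F k y
  F-* k x y = pow-* (2 ^ k) x y

  F-+ : ∀ k x y → F k (x + y) ≈ F k x + F k y
  F-+ zero    x y = trans (F-zero _) (sym (+-cong (F-zero x) (F-zero y)))
  F-+ (suc k) x y = begin
    F (suc k) (x + y)                     ≈⟨ F-sq k (x + y) ⟩
    F k (x + y) * F k (x + y)             ≈⟨ *-cong (F-+ k x y) (F-+ k x y) ⟩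
    (F k x + F k y) * (F k x + F k y)
      ≈⟨ solve 2 (λ a b → (a :+ b) :* (a :+ b) := a :* a :+ b :* b) refl _ _ ⟩
    F k x * F k x + F k y * F k y         ≈⟨ +-cong (F-sq k x) (F-sq k y) ⟨
    F (suc k) x + F (suc k) y             ∎

  F-1# : ∀ k → F k 1# ≈ 1#
  F-1# k = pow-1# (2 ^ k)

  F-0# : ∀ k → F k 0# ≈ 0#
  F-0# k = trans (F-cong k (sym (x+x≈0 1#))) (trans (F-+ k 1# 1#) (x+x≈0 _))

  -- Subfields are predicates on `K`, with closure lemmas in place of separate types; `Fixed k x` is
  -- `InSub K (2 ^ k) x` by definition.
  Fixed : ℕ → Carrier → Set ℓ
  Fixed k x = F k x ≈ x

  fixed-cong : ∀ k {x y} → x ≈ y → Fixed k x → Fixed k y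
  fixed-cong k x≈y fx = trans (F-cong k (sym x≈y)) (trans fx x≈y)

  fixed-+ : ∀ k {x y} → Fixed k x → Fixed k y → Fixed k (x + y)
  fixed-+ k fx fy = trans (F-+ k _ _) (+-cong fx fy)

  fixed-* : ∀ k {x y} → Fixed k x → Fixed k y → Fixed k (x * y)
  fixed-* k fx fy = trans (F-* k _ _) (*-cong fx fy)

  fixed-⁻¹ : ∀ k {x} → ¬ x ≈ 0# → Fixed k x → Fixed k (x ⁻¹)
  fixed-⁻¹ k {x} x≉0 fx = *-cancelˡ x≉0 (begin
    x * F k (x ⁻¹)     ≈⟨ *-congʳ fx ⟨
    F k x * F k (x ⁻¹) ≈⟨ F-* k _ _ ⟨
    F k (x * x ⁻¹)     ≈⟨ F-cong k (inverseʳ x x≉0) ⟩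
    F k 1#             ≈⟨ F-1# k ⟩
    1#                 ≈⟨ inverseʳ x x≉0 ⟨
    x * x ⁻¹           ∎)

  fixed-F : ∀ j k {x} → Fixed k x → Fixed k (F j x)
  fixed-F j k fx = trans (F-comm k j _) (F-cong j fx)

  fixed-multiple : ∀ k n {x} → Fixed k x → Fixed (k ℕ.* n) x
  fixed-multiple k zero    {x} fx rewrite ℕ.*-zeroʳ k = F-zero x
  fixed-multiple k (suc n) {x} fx rewrite ℕ.*-suc k n =
    trans (F-∘ k (k ℕ.* n) x) (trans (F-cong k (fixed-multiple k n fx)) fx)

  -- For x in the field of 2^(d n) elements, T d n x is its trace to the field of 2^d elements.
  T : ℕ → ℕ → Carrier → Carrier
  T d zero    x = 0#
  T d (suc n) x = T d n x + F (d ℕ.* n) x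

  T-cong : ∀ d n {x y} → x ≈ y → T d n x ≈ T d n y
  T-cong d zero    x≈y = refl
  T-cong d (suc n) x≈y = +-cong (T-cong d n x≈y) (F-cong (d ℕ.* n) x≈y)

  T-+ : ∀ d n x y → T d n (x + y) ≈ T d n x + T d n y
  T-+ d zero    x y = sym (+-identityʳ 0#)
  T-+ d (suc n) x y = trans (+-cong (T-+ d n x y) (F-+ (d ℕ.* n) x y))
    (+-interchange _ _ _ _)

  T-0# : ∀ d n → T d n 0# ≈ 0#
  T-0# d zero    = refl
  T-0# d (suc n) = trans (+-cong (T-0# d n) (F-0# (d ℕ.* n))) (+-identityʳ 0#)

  T-F : ∀ d n k x → T d n (F k x) ≈ F k (T d n x)
  T-F d zero    k x = sym (F-0# k)
  T-F d (suc n) k x = trans (+-cong (T-F d n k x) (F-comm (d ℕ.* n) k x)) (sym (F-+ k _ _))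

  T-sq : ∀ d n x → T d n (x * x) ≈ T d n x * T d n x
  T-sq d n x = trans (T-cong d n (sq x)) (trans (T-F d n 1 x) (sym (sq _)))
    where
    sq : ∀ x → x * x ≈ F 1 x
    sq x = sym (*-congˡ (*-identityʳ x))

  T-scale : ∀ d n {a} x → Fixed d a → T d n (a * x) ≈ a * T d n x
  T-scale d zero    x fa = sym (zeroʳ _)
  T-scale d (suc n) x fa = trans
    (+-cong (T-scale d n x fa) (trans (F-* (d ℕ.* n) _ x) (*-congʳ (fixed-multiple d n fa))))
    (sym (distribˡ _ _ _))

  -- Applying `F d` moves every summand one step on, so all but the two end terms cancel, whatever
  -- `x` is. For `x` in the field of 2^(d n) elements the ends cancel too.
  T-telescope : ∀ d n x → F d (T d n x) + T d n x ≈ F (d ℕ.* n) x + x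
  T-telescope d zero    x rewrite ℕ.*-zeroʳ d = trans (+-identityʳ _) (trans (F-0# d)
    (sym (trans (+-congʳ (F-zero x)) (x+x≈0 x))))
  T-telescope d (suc n) x = begin
    F d (T d n x + y) + (T d n x + y)      ≈⟨ +-congʳ (F-+ d _ y) ⟩
    (F d (T d n x) + F d y) + (T d n x + y) ≈⟨ +-interchange _ _ _ _ ⟩
    (F d (T d n x) + T d n x) + (F d y + y) ≈⟨ +-congʳ (T-telescope d n x) ⟩
    (y + x) + (F d y + y)
      ≈⟨ solve 3 (λ y x z → (y :+ x) :+ (z :+ y) := z :+ x) refl y x _ ⟩
    F d y + x                               ≈⟨ +-congʳ (F-∘ d (d ℕ.* n) x) ⟨
    F (d ℕ.+ d ℕ.* n) x + x                 ≈⟨ +-congʳ (F-≡ x (≡.sym (ℕ.*-suc d n))) ⟩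
    F (d ℕ.* suc n) x + x                   ∎
    where
    y : Carrier
    y = F (d ℕ.* n) x

  T-fixed : ∀ d n {x} → Fixed (d ℕ.* n) x → Fixed d (T d n x)
  T-fixed d n fx = x+y≈0⇒x≈y (trans (T-telescope d n _) (x≈y⇒x+y≈0 fx))

  T₁-split : ∀ a b x → T 1 (a ℕ.+ b) x ≈ T 1 a x + F a (T 1 b x)
  T₁-split a zero    x rewrite ℕ.+-identityʳ a = sym (trans (+-congˡ (F-0# a)) (+-identityʳ _))
  T₁-split a (suc b) x rewrite ℕ.+-suc a b | ℕ.+-identityʳ (a ℕ.+ b) | ℕ.+-identityʳ b =
    trans (+-cong (T₁-split a b x) (F-∘ a b x)) (trans (+-assoc _ _ _) (+-congˡ (sym (F-+ a _ _))))

  -- Grouping the exponents below a b as i + a j makes transitivity of the trace a formal identity,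
  -- valid for all `x`.
  T-trans : ∀ a b x → T 1 (a ℕ.* b) x ≈ T 1 a (T a b x)
  T-trans a zero    x rewrite ℕ.*-zeroʳ a = sym (T-0# 1 a)
  T-trans a (suc b) x = begin
    T 1 (a ℕ.* suc b) x                            ≈⟨ T≡ (≡.trans (ℕ.*-suc a b) (ℕ.+-comm a _)) ⟩
    T 1 (a ℕ.* b ℕ.+ a) x                          ≈⟨ T₁-split (a ℕ.* b) a x ⟩
    T 1 (a ℕ.* b) x + F (a ℕ.* b) (T 1 a x)        ≈⟨ +-cong (T-trans a b x) (sym (T-F 1 a (a ℕ.* b) x)) ⟩
    T 1 a (T a b x) + T 1 a (F (a ℕ.* b) x)        ≈⟨ T-+ 1 a _ _ ⟨
    T 1 a (T a (suc b) x)                          ∎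
    where
    T≡ : ∀ {j k} → j ≡ k → T 1 j x ≈ T 1 k x
    T≡ ≡.refl = refl

  idempotent⇒0∨1 : ∀ {x} → x * x + x ≈ 0# → x ≈ 0# ⊎ x ≈ 1#
  idempotent⇒0∨1 {x} eq with x ≟ 0#
  ... | yes x≈0 = inj₁ x≈0
  ... | no  x≉0 = inj₂ (*-cancelˡ x≉0 (trans (x+y≈0⇒x≈y eq) (sym (*-identityʳ x))))

  T₁-idempotent : ∀ n {x} → Fixed n x → T 1 n x * T 1 n x ≈ T 1 n x
  T₁-idempotent n {x} fx = trans (sym (*-congˡ (*-identityʳ _)))
    (T-fixed 1 n (trans (F-≡ x (ℕ.+-identityʳ n)) fx))

  T₁-value : ∀ n {x} → Fixed n x → T 1 n x ≈ 0# ⊎ T 1 n x ≈ 1#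
  T₁-value n fx = idempotent⇒0∨1 (x≈y⇒x+y≈0 (T₁-idempotent n fx))

  -- T 1 N is a polynomial function of degree 2^(N-1), so it cannot vanish on 2^N elements.
  trace-one-exists : ∀ n → card ≡ 2 ^ suc n → (∀ x → Fixed (suc n) x) → ∃[ θ ] T 1 (suc n) θ ≈ 1#
  trace-one-exists n card≡ fixed =
    let θ , Tθ≉0 = nonroot (2 ^ n) (poly-cong (2 ^ n) (+-identityˡ 1#)
                     (poly-+ (2 ^ n) (lower n n ℕ.≤-refl) (top n))) 1≉0
                     (≡.subst (2 ^ n <_) (≡.sym card≡) (ℕ.^-monoʳ-< 2 (s≤s (s≤s z≤n)) (ℕ.n<1+n n)))
    in θ , [ (λ e → contradiction e Tθ≉0) , (λ e → e) ]′ (T₁-value (suc n) (fixed θ))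
    where
    top : ∀ k → IsPoly (2 ^ k) 1# (F (1 ℕ.* k))
    top k rewrite ℕ.+-identityʳ k = poly-pow (2 ^ k)
    const-0 : ∀ d → IsPoly d 0# (λ _ → 0#)
    const-0 zero    = λ _ → refl
    const-0 (suc d) = poly-raise d (const-0 d)
    lower : ∀ k n → k ≤ n → IsPoly (2 ^ n) 0# (T 1 k)
    lower zero    n _   = const-0 (2 ^ n)
    lower (suc k) n k<n = poly-cong (2 ^ n) (+-identityʳ 0#) (poly-+ (2 ^ n)
      (lower k n (ℕ.<⇒≤ k<n))
      (poly-raise-< (ℕ.^-monoʳ-< 2 (s≤s (s≤s z≤n)) k<n) (top k)))

  -- Additive Hilbert 90, with the explicit solution Σⱼ (Σ_{i<j} c^(2^i)) θ^(2^j).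
  artin-schreier : ∀ n {θ c} → T 1 n θ ≈ 1# → Fixed n θ → T 1 n c ≈ 0# →
                   ∃[ r ] r * r + r ≈ c
  artin-schreier n {θ} {c} Tθ≈1 fθ Tc≈0 = R n , (begin
    R n * R n + R n                         ≈⟨ R-eq n ⟩
    T 1 n c * F n θ + c * (T 1 n θ + θ + F n θ)
      ≈⟨ +-cong (*-congʳ Tc≈0) (*-congˡ (+-cong (+-congʳ Tθ≈1) fθ)) ⟩
    0# * F n θ + c * (1# + θ + θ)
      ≈⟨ solve 3 (λ f c t → :0 :* f :+ c :* (:1 :+ t :+ t) := c) refl _ c θ ⟩
    c                                       ∎)
    where
    R : ℕ → Carrier
    R zero    = 0#
    R (suc j) = R j + T 1 j c * F j θ
    F-1* : ∀ k x → F (1 ℕ.* k) x ≈ F k x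
    F-1* k x = F-≡ x (ℕ.+-identityʳ k)
    T-step : ∀ k → T 1 k c * T 1 k c ≈ T 1 (suc k) c + c
    T-step k = begin
      T 1 k c * T 1 k c         ≈⟨ *-congˡ (*-identityʳ _) ⟨
      F 1 (T 1 k c)             ≈⟨ solve 2 (λ a b → a := b :+ (a :+ b)) refl _ (T 1 k c) ⟩
      T 1 k c + (F 1 (T 1 k c) + T 1 k c)  ≈⟨ +-congˡ (T-telescope 1 k c) ⟩
      T 1 k c + (F (1 ℕ.* k) c + c) ≈⟨ +-assoc _ _ _ ⟨
      T 1 (suc k) c + c         ∎
    -- An invariant of the partial sums: T 1 k θ + θ + F k θ is the sum of F 1 θ up to F k θ. At k =
    -- n the hypotheses leave c (1 + θ + θ) = c.
    R-eq : ∀ k → R k * R k + R k ≈ T 1 k c * F k θ + c * (T 1 k θ + θ + F k θ)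
    R-eq zero    = trans
      (solve 2 (λ c t → :0 :* :0 :+ :0 := :0 :* t :+ c :* (:0 :+ t :+ t)) refl c θ)
      (+-cong (*-congˡ (sym (F-zero θ))) (*-congˡ (+-congˡ (sym (F-zero θ)))))
    R-eq (suc k) = begin
      (r + t * f) * (r + t * f) + (r + t * f)
        ≈⟨ solve 3 (λ r t f → (r :+ t :* f) :* (r :+ t :* f) :+ (r :+ t :* f)
                      := (r :* r :+ r) :+ (t :* t :* (f :* f) :+ t :* f)) refl r t f ⟩
      (r * r + r) + (t * t * (f * f) + t * f)
        ≈⟨ +-cong (R-eq k) (+-congʳ (*-cong (T-step k) (sym (F-sq k θ)))) ⟩
      (t * f + c * (T 1 k θ + θ + f)) + ((t′ + c) * f′ + t * f)
        ≈⟨ solve 7 (λ t f c s θ t′ f′ → (t :* f :+ c :* (s :+ θ :+ f)) :+ ((t′ :+ c) :* f′ :+ t :* f)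
                      := t′ :* f′ :+ c :* ((s :+ f) :+ θ :+ f′)) refl t f c (T 1 k θ) θ t′ f′ ⟩
      t′ * f′ + c * ((T 1 k θ + f) + θ + f′)
        ≈⟨ +-congˡ (*-congˡ (+-congʳ (+-congʳ (+-congˡ (F-1* k θ))))) ⟨
      t′ * f′ + c * (T 1 (suc k) θ + θ + f′) ∎
      where
      r t f t′ f′ : Carrier
      r  = R k
      t  = T 1 k c
      f  = F k θ
      t′ = T 1 (suc k) c
      f′ = F (suc k) θ

-- Distances and syndromes: the covering radius as a number of terms.

length-filter-tabulate : ∀ {a p q} {A : Set a} {P : Pred A p} {Q : Pred A q}
  (P? : Decidable P) (Q? : Decidable Q) {n} (f : Fin n → A) →
  (∀ i → P (f i) → Q (f i)) →
  length (filter P? (tabulate f)) ≤ length (filter Q? (tabulate f))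
length-filter-tabulate P? Q? {zero}  f P⇒Q = z≤n
length-filter-tabulate P? Q? {suc n} f P⇒Q
  with P? (f zero) | Q? (f zero) | length-filter-tabulate P? Q? (f ∘ suc) (P⇒Q ∘ suc)
... | yes _ | yes _ | rest = s≤s rest
... | yes p | no ¬q | _    = contradiction (P⇒Q zero p) ¬q
... | no _  | yes _ | rest = ℕ.m≤n⇒m≤1+n rest
... | no _  | no _  | rest = rest

-- Meant for a word changed in the single coordinate `j`, which accounts for at most one
-- disagreement.
length-filter-tabulate-except : ∀ {a p q} {A : Set a} {P : Pred A p} {Q : Pred A q}
  (P? : Decidable P) (Q? : Decidable Q) {n} (f : Fin n → A) j →
  (∀ i → ¬ i ≡ j → P (f i) → Q (f i)) →
  length (filter P? (tabulate f)) ≤ suc (length (filter Q? (tabulate f)))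
length-filter-tabulate-except P? Q? f zero P⇒Q
  with P? (f zero) | Q? (f zero)
     | length-filter-tabulate P? Q? (f ∘ suc) (λ i → P⇒Q (suc i) λ ())
... | yes _ | yes _ | rest = s≤s (ℕ.m≤n⇒m≤1+n rest)
... | yes _ | no _  | rest = s≤s rest
... | no _  | yes _ | rest = ℕ.m≤n⇒m≤1+n (ℕ.m≤n⇒m≤1+n rest)
... | no _  | no _  | rest = ℕ.m≤n⇒m≤1+n rest
length-filter-tabulate-except P? Q? f (suc j) P⇒Q
  with P? (f zero) | Q? (f zero)
     | length-filter-tabulate-except P? Q? (f ∘ suc) j
         (λ i i≢j → P⇒Q (suc i) (i≢j ∘ Fin.suc-injective))
... | yes _ | yes _ | rest = s≤s rest
... | yes p | no ¬q | _    = contradiction (P⇒Q zero (λ ()) p) ¬q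
... | no _  | yes _ | rest = ℕ.m≤n⇒m≤1+n rest
... | no _  | no _  | rest = rest

module Syndromes {c ℓ} (K : FiniteField c ℓ)
  (1+1≈0 : Characteristic2 K)
  (m q : ℕ) where
  open Char2 K 1+1≈0

  H : Carrier → Set ℓ
  H t = t ^^ suc q ≈ 1#

  -- z is a sum of k terms a t with a ∈ 𝔽_{2^m} and t ∈ H; repetitions and a ≈ 0 are allowed.
  Rep : ℕ → Carrier → Set (c ⊔ ℓ)
  Rep zero    z = Lift c (z ≈ 0#)
  Rep (suc k) z = ∃[ a ] ∃[ t ] Fixed m a × H t × Rep k (z + a * t)

  rep-cong : ∀ k {y z} → y ≈ z → Rep k y → Rep k z
  rep-cong zero    y≈z (lift y≈0)          = lift (trans (sym y≈z) y≈0)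
  rep-cong (suc k) y≈z (a , t , fa , Ht , rep) = a , t , fa , Ht , rep-cong k (+-congʳ y≈z) rep

  H-1# : H 1#
  H-1# = pow-1# (suc q)

  H-* : ∀ {s t} → H s → H t → H (s * t)
  H-* Hs Ht = trans (pow-* (suc q) _ _) (trans (*-cong Hs Ht) (*-identityˡ 1#))

  H-cong : ∀ {s t} → s ≈ t → H s → H t
  H-cong s≈t Hs = trans (pow-cong (suc q) (sym s≈t)) Hs

  rep-suc : ∀ k {z} → Rep k z → Rep (suc k) z
  rep-suc k rep = 0# , 1# , F-0# m , H-1# ,
    rep-cong k (sym (trans (+-congˡ (zeroˡ 1#)) (+-identityʳ _))) rep

  rep-mono : ∀ {j k z} → j ≤ k → Rep j z → Rep k z
  rep-mono {zero}  {zero}  _        rep = rep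
  rep-mono {zero}  {suc k} _        rep = rep-suc k (rep-mono {zero} {k} z≤n rep)
  rep-mono {suc j} {suc k} (s≤s j≤k) (a , t , fa , Ht , rep) = a , t , fa , Ht , rep-mono j≤k rep

  -- `H` is a group, so multiplication by `h` only moves the points; a factor in `H` can thus be
  -- stripped from a syndrome.
  rep-scale : ∀ k {h z} → H h → Rep k z → Rep k (h * z)
  rep-scale zero    Hh (lift z≈0) = lift (trans (*-congˡ z≈0) (zeroʳ _))
  rep-scale (suc k) {h} {z} Hh (a , t , fa , Ht , rep) = a , h * t , fa , H-* Hh Ht ,
    rep-cong k (solve 4 (λ h z a t → h :* (z :+ a :* t) := h :* z :+ a :* (h :* t)) refl h z a t)
      (rep-scale k Hh rep)

  private
    size : ℕ
    size = length (Hlist K q)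

    point : Fin size → Carrier
    point = lookup (Hlist K q)

    H? : ∀ x → Dec (H x)
    H? x = (x ^^ suc q) ≟ 1#

    point∈H : ∀ i → H (point i)
    point∈H i = proj₂ (∈-filter⁻ setoid H? H-cong {xs = elems} (∈-lookup setoid (Hlist K q) i))

    index : ∀ {t} → H t → ∃[ i ] t ≈ point i
    index Ht = let t∈ = ∈-filter⁺ setoid H? H-cong (complete _) Ht
               in Any.index t∈ , Any.lookup-index t∈

    Σ : List Carrier → Carrier
    Σ = foldr _+_ 0#

    Σ-cong : ∀ {n} (f g : Fin n → Carrier) → (∀ i → f i ≈ g i) → Σ (tabulate f) ≈ Σ (tabulate g)
    Σ-cong {zero}  f g f≈g = refl
    Σ-cong {suc n} f g f≈g = +-cong (f≈g zero) (Σ-cong (f ∘ suc) (g ∘ suc) (f≈g ∘ suc))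

    Σ-update : ∀ {n} (f g : Fin n → Carrier) j a → g j ≈ f j + a → (∀ i → ¬ i ≡ j → g i ≈ f i) →
               Σ (tabulate g) ≈ Σ (tabulate f) + a
    Σ-update f g zero a gj rest = trans
      (+-cong gj (Σ-cong (g ∘ suc) (f ∘ suc) (λ i → rest (suc i) λ ())))
      (solve 3 (λ x a y → (x :+ a) :+ y := (x :+ y) :+ a) refl _ a _)
    Σ-update f g (suc j) a gj rest = trans
      (+-cong (rest zero λ ())
        (Σ-update (f ∘ suc) (g ∘ suc) j a gj (λ i i≢j → rest (suc i) (i≢j ∘ Fin.suc-injective))))
      (sym (+-assoc _ _ _))

    synd≡ : ∀ v → synd K q v ≡ Σ (tabulate (λ i → v i * point i))
    synd≡ v = ≡.cong Σ (map-tabulate id (λ i → v i * point i))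

    update : Word K q → Fin size → Carrier → Word K q
    update v j a i with i Fin.≟ j
    ... | yes _ = v i + a
    ... | no  _ = v i

    update-at : ∀ v j a → update v j a j ≡ v j + a
    update-at v j a with j Fin.≟ j
    ... | yes _   = ≡.refl
    ... | no  j≢j = contradiction ≡.refl j≢j

    update-off : ∀ v j a {i} → ¬ i ≡ j → update v j a i ≡ v i
    update-off v j a {i} i≢j with i Fin.≟ j
    ... | yes i≡j = contradiction i≡j i≢j
    ... | no  _   = ≡.refl

    update-word : ∀ {v a} j → IsWord K (2 ^ m) q v → Fixed m a → IsWord K (2 ^ m) q (update v j a)
    update-word j isWord fa i with i Fin.≟ j
    ... | yes _ = fixed-+ m (isWord i) fa
    ... | no  _ = isWord i

    synd-update : ∀ v j a → synd K q (update v j a) ≈ synd K q v + a * point j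
    synd-update v j a rewrite synd≡ v | synd≡ (update v j a) =
      Σ-update _ _ j (a * point j)
        (trans (*-congʳ (reflexive (update-at v j a))) (distribʳ _ _ _))
        (λ i i≢j → *-congʳ (reflexive (update-off v j a i≢j)))

  -- Adding `a` at the coordinate of `t` adds `a * t` to the syndrome, which in characteristic 2
  -- removes that term, at the cost of one changed coordinate. A repeated point costs no more.
  rep⇒close : ∀ k v → IsWord K (2 ^ m) q v → Rep k (synd K q v) →
              ∃[ w ] InCode K (2 ^ m) q w × dist K q v w ≤ k
  rep⇒close zero v isWord (lift s≈0) = v , (isWord , s≈0) ,
    ℕ.≤-reflexive (≡.cong length (filter-none (λ i → ¬? (v i ≟ v i))
      (All.universal (λ i v≉v → v≉v refl) (allFin size))))
  rep⇒close (suc k) v isWord (a , t , fa , Ht , rep) =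
    let j , t≈ = index Ht
        w , inCode , close = rep⇒close k (update v j a) (update-word j isWord fa)
          (rep-cong k (trans (+-congˡ (*-congˡ t≈)) (sym (synd-update v j a))) rep)
    in w , inCode , ℕ.≤-trans
         (length-filter-tabulate-except _ _ id j
           (λ i i≢j v≉w v′≈w → v≉w (trans (reflexive (≡.sym (update-off v j a i≢j))) v′≈w)))
         (s≤s close)

  rep⇒syndrome : ∀ k {z} → Rep k z → ∃[ v ] IsWord K (2 ^ m) q v × synd K q v ≈ z
  rep⇒syndrome zero (lift z≈0) = (λ _ → 0#) , (λ _ → F-0# m) ,
    trans (zero-sum (allFin size)) (sym z≈0)
    where
    zero-sum : ∀ is → Σ (map (λ i → 0# * point i) is) ≈ 0#
    zero-sum []       = refl
    zero-sum (i ∷ is) = trans (+-cong (zeroˡ _) (zero-sum is)) (+-identityʳ 0#)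
  rep⇒syndrome (suc k) {z} (a , t , fa , Ht , rep) =
    let v , isWord , s≈ = rep⇒syndrome k rep
        j , t≈ = index Ht
    in update v j a , update-word j isWord fa , trans (synd-update v j a) (trans
         (+-cong s≈ (*-congˡ (sym t≈)))
         (solve 2 (λ z x → (z :+ x) :+ x := z) refl z _))

  -- A codeword adds nothing to the syndrome, so the syndrome of `v` is that of v + w, which is
  -- supported on the coordinates where the two words differ.
  close⇒rep : ∀ v w → IsWord K (2 ^ m) q v → InCode K (2 ^ m) q w → Rep (dist K q v w) (synd K q v)
  close⇒rep v w v-word (w-word , w-synd) = rep-cong (dist K q v w)
    (trans (+-congˡ w-synd) (+-identityʳ _)) (go (allFin size))
    where
    go : ∀ is → Rep (length (filter (λ i → ¬? (v i ≟ w i)) is))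
      (Σ (map (λ i → v i * point i) is) + Σ (map (λ i → w i * point i) is))
    go []       = lift (+-identityʳ 0#)
    go (i ∷ is) with v i ≟ w i
    ... | yes vi≈wi = rep-cong (length (filter (λ i → ¬? (v i ≟ w i)) is))
      (by₁ (point i) vi≈wi (solve 5 (λ v w p s t →
         (s :+ t) :+ ((v :* p :+ s) :+ (w :* p :+ t)) := p :* (v :+ w)) refl _ _ _ _ _)) (go is)
    ... | no _ = v i + w i , point i , fixed-+ m (v-word i) (w-word i) , point∈H i ,
      rep-cong (length (filter (λ i → ¬? (v i ≟ w i)) is))
      (solve 5 (λ v w p s t →
         s :+ t := ((v :* p :+ s) :+ (w :* p :+ t)) :+ (v :+ w) :* p) refl _ _ _ _ _) (go is)

  -- The far word is a word with syndrome z, which exists because z is itself a sum of r + 1 terms;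
  -- a closer codeword would write z with r terms.
  coveringRadius : ∀ r → (∀ z → Rep (suc r) z) → ∃[ z ] ¬ Rep r z →
                   CoveringRadiusIs K (2 ^ m) q (suc r)
  coveringRadius r all (z , ¬rep) =
    (λ v isWord → rep⇒close (suc r) v isWord (all _)) ,
    (let v , isWord , s≈z = rep⇒syndrome (suc r) (all z)
     in v , isWord , λ w inCode → ℕ.≰⇒> λ close →
          ¬rep (rep-cong r s≈z (rep-mono close (close⇒rep v w isWord inCode))))

  coveringRadius⇒¬rep : ∀ r → CoveringRadiusIs K (2 ^ m) q (suc r) → ∃[ z ] ¬ Rep r z
  coveringRadius⇒¬rep r (_ , v , isWord , far) = synd K q v , λ rep →
    let w , inCode , close = rep⇒close r v isWord rep
    in contradiction (far w inCode) (ℕ.<⇒≱ (s≤s close))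

-- Norms, polar decomposition and elements of trace 1.

module Covering {c ℓ} (K : FiniteField c ℓ)
  (1+1≈0 : Characteristic2 K)
  (m s : ℕ) (1≤m : 1 ≤ m) (2≤s : 2 ≤ s)
  (card≡ : FiniteField.card K ≡ 2 ^ (m ℕ.* s ℕ.* 2)) where
  open Char2 K 1+1≈0
  open Syndromes K 1+1≈0 m (2 ^ (m ℕ.* s))

  private
    n : ℕ
    n = m ℕ.* s

    k+k≡k*2 : ∀ k → k ℕ.+ k ≡ k ℕ.* 2
    k+k≡k*2 k = ≡.trans (≡.cong (k ℕ.+_) (≡.sym (ℕ.+-identityʳ k))) (ℕ.*-comm 2 k)

    fixed-2n : ∀ x → Fixed (n ℕ.* 2) x
    fixed-2n x = ≡.subst (λ k → x ^^ k ≈ x) card≡ (pow-card x)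

  conj : Carrier → Carrier
  conj = F n

  τ : Carrier → Carrier
  τ = T 1 n

  Tr₀ : Carrier → Carrier
  Tr₀ = T m s

  -- With q = 2^n this is z^(q+1), so `norm t ≈ 1#` and `H t` agree by definition.
  norm : Carrier → Carrier
  norm z = z * conj z

  conj-involutive : ∀ x → conj (conj x) ≈ x
  conj-involutive x = trans (sym (F-∘ n n x)) (trans
    (F-≡ x (k+k≡k*2 n)) (fixed-2n x))

  sub : ∀ {x} → Fixed m x → Fixed n x
  sub = fixed-multiple m s

  outside⇒≉0 : ∀ {y} → ¬ Fixed m y → ¬ y ≈ 0#
  outside⇒≉0 ¬fy y≈0 = ¬fy (fixed-cong m (sym y≈0) (F-0# m))

  norm-fixed : ∀ z → Fixed n (norm z)
  norm-fixed z = trans (F-* n z _) (trans (*-congˡ (conj-involutive z)) (*-comm _ _))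

  norm-* : ∀ x y → norm (x * y) ≈ norm x * norm y
  norm-* x y = trans (*-congˡ (F-* n x y)) (*-interchange x y _ _)

  norm-≉0 : ∀ {z} → ¬ z ≈ 0# → ¬ norm z ≈ 0#
  norm-≉0 z≉0 = *-≉0 z≉0 (pow-≉0 (2 ^ n) z≉0)

  ≉0-of-norm : ∀ {z} → ¬ norm z ≈ 0# → ¬ z ≈ 0#
  ≉0-of-norm norm≉0 z≈0 = norm≉0 (trans (*-congʳ z≈0) (zeroˡ _))

  inverse-unique : ∀ {x z} → ¬ x ≈ 0# → x * z ≈ 1# → z ≈ x ⁻¹
  inverse-unique {x} x≉0 xz≈1 = *-cancelˡ x≉0 (trans xz≈1 (sym (inverseʳ x x≉0)))

  ⁻¹-cong : ∀ {x y} → ¬ x ≈ 0# → x ≈ y → x ⁻¹ ≈ y ⁻¹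
  ⁻¹-cong {x} x≉0 x≈y = inverse-unique (λ y≈0 → x≉0 (trans x≈y y≈0))
    (trans (*-congʳ (sym x≈y)) (inverseʳ x x≉0))

  ⁻¹-involutive : ∀ {x} → ¬ x ≈ 0# → (x ⁻¹) ⁻¹ ≈ x
  ⁻¹-involutive x≉0 = sym (inverse-unique (⁻¹-≉0 x≉0) (inverseˡ x≉0))

  equal-norms : ∀ {y z} → norm y ≈ norm z → ¬ z ≈ 0# → ∃[ h ] H h × y ≈ h * z
  equal-norms {y} {z} eq z≉0 = y * z ⁻¹ ,
    (begin
      norm (y * z ⁻¹)        ≈⟨ norm-* y _ ⟩
      norm y * norm (z ⁻¹)   ≈⟨ *-congʳ eq ⟩
      norm z * norm (z ⁻¹)   ≈⟨ norm-* z _ ⟨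
      norm (z * z ⁻¹)        ≈⟨ *-cong z*z⁻¹≈1 (F-cong n z*z⁻¹≈1) ⟩
      norm 1#                ≈⟨ H-1# ⟩
      1#                     ∎) ,
    (begin
      y                  ≈⟨ *-identityʳ y ⟨
      y * 1#             ≈⟨ *-congˡ (inverseˡ z≉0) ⟨
      y * (z ⁻¹ * z)     ≈⟨ *-assoc _ _ _ ⟨
      y * z ⁻¹ * z       ∎)
    where
    z*z⁻¹≈1 : z * z ⁻¹ ≈ 1#
    z*z⁻¹≈1 = inverseʳ z z≉0

  norm-fixed-sq : ∀ {y} → Fixed n y → norm y ≈ y * y
  norm-fixed-sq fy = *-congˡ fy

  1≤n : 1 ≤ n
  1≤n = ℕ.*-mono-≤ 1≤m (ℕ.≤-trans (s≤s z≤n) 2≤s)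

  private
    predecessor : ∃[ k ] n ℕ.* 2 ≡ suc k
    predecessor with n ℕ.* 2 | ℕ.*-mono-≤ 1≤n (s≤s (z≤n {1}))
    ... | suc k | _ = k , ≡.refl

  polar : ∀ z → ¬ z ≈ 0# → ∃[ y ] ∃[ h ] Fixed n y × H h × ¬ y ≈ 0# × z ≈ h * y
  polar z z≉0 =
    let k , 2n≡ = predecessor
        -- The square root of the norm: one more squaring completes F (2 n), the identity on `K`. As
        -- `y` lies in 𝔽_q, its norm is y², the norm of `z`.
        y = F k (norm z)
        y*y≈ : y * y ≈ norm z
        y*y≈ = trans (sym (F-sq k _)) (trans (F-≡ _ (≡.sym 2n≡)) (fixed-2n _))
        fy : Fixed n y
        fy = fixed-F k n (norm-fixed z)
        y≉0 : ¬ y ≈ 0#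
        y≉0 = pow-≉0 (2 ^ k) (norm-≉0 z≉0)
        h , Hh , z≈ = equal-norms (trans (sym y*y≈) (sym (norm-fixed-sq fy))) y≉0
    in y , h , fy , Hh , y≉0 , z≈

  private
    -- By transitivity of the trace, one `θ` of absolute trace 1 yields `w₀` in 𝔽_q and `a₀` in
    -- 𝔽_{q₀} with the same property.
    trace-one : ∃[ θ ] T 1 (n ℕ.* 2) θ ≈ 1#
    trace-one with predecessor
    ... | k , 2n≡ =
      let θ , e = trace-one-exists k (≡.trans card≡ (≡.cong (2 ^_) 2n≡))
                    (λ x → trans (F-≡ x (≡.sym 2n≡)) (fixed-2n x))
      in θ , ≡.subst (λ j → T 1 j θ ≈ 1#) (≡.sym 2n≡) e

    θ : Carrier
    θ = proj₁ trace-one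

    w₀ : Carrier
    w₀ = T n 2 θ

    fixed-w₀ : Fixed n w₀
    fixed-w₀ = T-fixed n 2 (fixed-2n θ)

    τw₀≈1 : τ w₀ ≈ 1#
    τw₀≈1 = trans (sym (T-trans n 2 θ)) (proj₂ trace-one)

    a₀ : Carrier
    a₀ = Tr₀ w₀

    fixed-a₀ : Fixed m a₀
    fixed-a₀ = T-fixed m s fixed-w₀

    T₁a₀≈1 : T 1 m a₀ ≈ 1#
    T₁a₀≈1 = trans (sym (T-trans m s w₀)) τw₀≈1

  -- Points of `H` from elements of trace 1, and sums of two terms.

  τ≈1⇒≉0 : ∀ {w} → τ w ≈ 1# → ¬ w ≈ 0#
  τ≈1⇒≉0 τw≈1 w≈0 = 1≉0 (trans (sym τw≈1) (trans (T-cong 1 n w≈0) (T-0# 1 n)))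

  τ-sq : ∀ {x} → Fixed n x → τ (x * x) ≈ τ x
  τ-sq fx = trans (T-sq 1 n _) (T₁-idempotent n fx)

  -- The sum telescopes for any `r` in `K`, so the value measures whether `r` lies in 𝔽_q.
  τ-artin-schreier : ∀ r → τ (r * r + r) ≈ conj r + r
  τ-artin-schreier r = begin
    τ (r * r + r)         ≈⟨ T-+ 1 n _ _ ⟩
    τ (r * r) + τ r       ≈⟨ +-congʳ (T-sq 1 n r) ⟩
    τ r * τ r + τ r       ≈⟨ +-congʳ (*-congˡ (*-identityʳ (τ r))) ⟨
    F 1 (τ r) + τ r       ≈⟨ T-telescope 1 n r ⟩
    F (1 ℕ.* n) r + r     ≈⟨ +-congʳ (F-≡ r (ℕ.*-identityˡ n)) ⟩
    conj r + r            ∎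

  -- The equation r² + r = w² is solvable in `K`, since the absolute trace of w² from `K` is τ(w²) +
  -- τ(w²) = 0. By `τ-artin-schreier`, r + conj r = τ w = 1. So r has norm r (r + 1) = w², and t = r
  -- / w has norm 1 with t + conj t = 1 / w.
  circle-point : ∀ {w} → Fixed n w → τ w ≈ 1# → ∃[ t ] H t × (t + conj t) * w ≈ 1#
  circle-point {w} fw τw≈1 = t , Ht , t+t̄
    where
    w≉0 : ¬ w ≈ 0#
    w≉0 = τ≈1⇒≉0 τw≈1
    u : Carrier
    u = w ⁻¹
    uw≈1 : u * w ≈ 1#
    uw≈1 = inverseˡ w≉0
    trace-zero : T 1 (n ℕ.* 2) (w * w) ≈ 0#
    trace-zero = begin
      T 1 (n ℕ.* 2) (w * w)   ≈⟨ T-trans n 2 _ ⟩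
      τ (T n 2 (w * w))       ≈⟨ T-cong 1 n (+-cong
        (trans (+-identityˡ _) (fixed-multiple n 0 fw²)) (fixed-multiple n 1 fw²)) ⟩
      τ (w * w + w * w)       ≈⟨ T-cong 1 n (x+x≈0 _) ⟩
      τ 0#                    ≈⟨ T-0# 1 n ⟩
      0#                      ∎
      where
      fw² : Fixed n (w * w)
      fw² = fixed-* n fw fw
    root : ∃[ r ] r * r + r ≈ w * w
    root = artin-schreier (n ℕ.* 2) (proj₂ trace-one) (fixed-2n θ) trace-zero
    r : Carrier
    r = proj₁ root
    conj-r : conj r + r ≈ 1#
    conj-r = trans (sym (τ-artin-schreier r)) (trans (T-cong 1 n (proj₂ root)) (trans (τ-sq fw) τw≈1))
    t : Carrier
    t = u * r
    conj-t : conj t ≈ u * conj r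
    conj-t = trans (F-* n u r) (*-congʳ (fixed-⁻¹ n w≉0 fw))
    conj-t′ : conj t ≈ u * (r + 1#)
    conj-t′ = trans conj-t (*-congˡ (by₁ 1# conj-r
      (solve 2 (λ r r′ → r′ :+ (r :+ :1) := :1 :* ((r′ :+ r) :+ :1)) refl r (conj r))))
    Ht : H t
    Ht = trans (*-congˡ conj-t′) (by₂ (u * u) (u * w + 1#) (proj₂ root) uw≈1
      (solve 3 (λ u r w → u :* r :* (u :* (r :+ :1)) :+ :1
         := u :* u :* ((r :* r :+ r) :+ w :* w) :+ (u :* w :+ :1) :* (u :* w :+ :1)) refl u r w))
    t+t̄ : (t + conj t) * w ≈ 1#
    t+t̄ = trans (*-congʳ (+-congˡ conj-t′)) (by₁ 1# uw≈1
      (solve 3 (λ u r w → (u :* r :+ u :* (r :+ :1)) :* w :+ :1 := :1 :* (u :* w :+ :1)) refl u r w))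

  -- This is y / (y + b)², written as the sum in which it arises in `τ-to-Tr₀`.
  g : Carrier → Carrier → Carrier
  g y b = (y + b) ⁻¹ + b * ((y + b) ⁻¹ * (y + b) ⁻¹)

  module _ {y b} (fy : Fixed n y) (¬fy : ¬ Fixed m y) (fb : Fixed m b) where
    y+b≉0 : ¬ y + b ≈ 0#
    y+b≉0 y+b≈0 = ¬fy (fixed-cong m (sym (x+y≈0⇒x≈y y+b≈0)) fb)

    private
      v : Carrier
      v = (y + b) ⁻¹

    v*[y+b] : (y + b) ⁻¹ * (y + b) ≈ 1#
    v*[y+b] = inverseˡ y+b≉0

    fixed-v : Fixed n ((y + b) ⁻¹)
    fixed-v = fixed-⁻¹ n y+b≉0 (fixed-+ n fy (sub fb))

    fixed-g : Fixed n (g y b)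
    fixed-g = fixed-+ n fixed-v (fixed-* n (sub fb) (fixed-* n fixed-v fixed-v))

    g-cong : ∀ {b′} → b ≈ b′ → g y b ≈ g y b′
    g-cong b≈b′ = let v≈v′ = ⁻¹-cong y+b≉0 (+-congˡ b≈b′)
                  in +-cong v≈v′ (*-cong b≈b′ (*-cong v≈v′ v≈v′))

    -- Since a (a + b) v² = (a v)² + a b v² and squaring keeps the absolute trace, an expression
    -- quadratic in `a` has the trace of a linear one.
    τ-to-Tr₀ : ∀ {a} → Fixed m a → τ (a * (a + b) * (v * v)) ≈ T 1 m (a * Tr₀ (g y b))
    τ-to-Tr₀ {a} fa = begin
      τ (a * (a + b) * (v * v))                     ≈⟨ T-cong 1 n (solve 3 (λ a b v →
        a :* (a :+ b) :* (v :* v) := a :* v :* (a :* v) :+ a :* (b :* (v :* v))) refl a b v) ⟩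
      τ (a * v * (a * v) + a * (b * (v * v)))       ≈⟨ T-+ 1 n _ _ ⟩
      τ (a * v * (a * v)) + τ (a * (b * (v * v)))   ≈⟨ +-congʳ (τ-sq (fixed-* n (sub fa) fixed-v)) ⟩
      τ (a * v) + τ (a * (b * (v * v)))             ≈⟨ T-+ 1 n _ _ ⟨
      τ (a * v + a * (b * (v * v)))                 ≈⟨ T-cong 1 n (distribˡ _ _ _) ⟨
      τ (a * g y b)                                 ≈⟨ T-trans m s _ ⟩
      T 1 m (Tr₀ (a * g y b))                       ≈⟨ T-cong 1 m (T-scale m s _ fa) ⟩
      T 1 m (a * Tr₀ (g y b))                       ∎

    nonzero-trace⇒rep₂ : ¬ Tr₀ (g y b) ≈ 0# → Rep 2 y
    nonzero-trace⇒rep₂ Tr≉0 = rep-cong 2 (sym y≈) (rep-scale 2 Hh rep)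
      where
      γ a w : Carrier
      γ = Tr₀ (g y b)
      -- Chosen so that a γ = `a₀`, which has absolute trace 1.
      a = a₀ * γ ⁻¹
      w = a * (a + b) * (v * v)
      fa : Fixed m a
      fa = fixed-* m fixed-a₀ (fixed-⁻¹ m Tr≉0 (T-fixed m s fixed-g))
      τw≈1 : τ w ≈ 1#
      τw≈1 = trans (τ-to-Tr₀ fa) (trans (T-cong 1 m
        (trans (*-assoc _ _ _) (trans (*-congˡ (inverseˡ Tr≉0)) (*-identityʳ a₀)))) T₁a₀≈1)
      fixed-w : Fixed n w
      fixed-w = fixed-* n (fixed-* n (sub fa) (fixed-+ n (sub fa) (sub fb))) (fixed-* n fixed-v fixed-v)
      point : ∃[ t ] H t × (t + conj t) * w ≈ 1#
      point = circle-point fixed-w τw≈1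
      t t̄ z : Carrier
      t = proj₁ point
      t̄ = conj t
      -- Since t + conj t = 1 / w, the norm of `z` is a² + (a + b)² + (y + b)² = y², so `y` is `z`
      -- times a point of `H`.
      z = a + (a + b) * t
      tt̄≈1 : t * t̄ ≈ 1#
      tt̄≈1 = proj₁ (proj₂ point)
      conj-z : conj z ≈ a + (a + b) * t̄
      conj-z = trans (F-+ n a _) (+-cong (sub fa)
        (trans (F-* n _ t) (*-congʳ (fixed-+ n (sub fa) (sub fb)))))
      a[a+b][t+t̄] : a * (a + b) * (t + t̄) ≈ (y + b) * (y + b)
      a[a+b][t+t̄] = by₂ (a * (a + b) * (t + t̄) * (v * (y + b) + 1#)) ((y + b) * (y + b))
        v*[y+b] (proj₂ (proj₂ point))
        (solve 5 (λ a b y v s → a :* (a :+ b) :* s :+ (y :+ b) :* (y :+ b)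
           := a :* (a :+ b) :* s :* (v :* (y :+ b) :+ :1) :* (v :* (y :+ b) :+ :1)
              :+ (y :+ b) :* (y :+ b) :* (s :* (a :* (a :+ b) :* (v :* v)) :+ :1)) refl a b y v (t + t̄))
      norm-z : norm z ≈ norm y
      norm-z = trans (*-congˡ conj-z) (trans (by₂ ((a + b) * (a + b)) 1# tt̄≈1 a[a+b][t+t̄]
        (solve 5 (λ a b y t t̄ → (a :+ (a :+ b) :* t) :* (a :+ (a :+ b) :* t̄) :+ y :* y
           := (a :+ b) :* (a :+ b) :* (t :* t̄ :+ :1)
              :+ :1 :* (a :* (a :+ b) :* (t :+ t̄) :+ (y :+ b) :* (y :+ b))) refl a b y t t̄))
        (sym (norm-fixed-sq fy)))
      y≉0 : ¬ y ≈ 0#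
      y≉0 = outside⇒≉0 ¬fy
      same : ∃[ h ] H h × y ≈ h * z
      same = equal-norms (sym norm-z)
        (≉0-of-norm (λ e → norm-≉0 y≉0 (trans (sym norm-z) e)))
      Hh : H (proj₁ same)
      Hh = proj₁ (proj₂ same)
      y≈ : y ≈ proj₁ same * z
      y≈ = proj₂ (proj₂ same)
      rep : Rep 2 z
      rep = a , 1# , fa , H-1# , a + b , t , fixed-+ m fa fb , tt̄≈1 , lift
        (solve 3 (λ a b t → (a :+ (a :+ b) :* t) :+ a :* :1 :+ (a :+ b) :* t := :0) refl a b t)

  -- This runs `circle-point` backwards. With x = t₁ / t₂, the norm of y gives (y + b)² = a a′ (x +
  -- 1/x). For w = a a′ / (y + b)², the element r = x w then satisfies r² + r = w² and r + conj r =
  -- 1, which forces τ w = 1.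
  rep₂⇒nonzero-trace : ∀ {y} → Fixed n y → ¬ Fixed m y → Rep 2 y →
                       ∃[ b ] Fixed m b × ¬ Tr₀ (g y b) ≈ 0#
  rep₂⇒nonzero-trace {y} fy ¬fy (a , t₁ , fa , Ht₁ , a′ , t₂ , fa′ , Ht₂ , lift eq) =
    b , fb , λ Tr≈0 → 1≉0 (begin
      1#                              ≈⟨ τw≈1 ⟨
      τ w                             ≈⟨ T-cong 1 n (solve 3 (λ a a′ v → a :* a′ :* (v :* v)
                                           := a :* (a :+ (a :+ a′)) :* (v :* v)) refl a a′ v) ⟩
      τ (a * (a + b) * (v * v))       ≈⟨ τ-to-Tr₀ fy ¬fy fb fa ⟩
      T 1 m (a * Tr₀ (g y b))         ≈⟨ T-cong 1 m (trans (*-congˡ Tr≈0) (zeroʳ a)) ⟩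
      T 1 m 0#                        ≈⟨ T-0# 1 m ⟩
      0#                              ∎)
    where
    b v w x x̄ r : Carrier
    b = a + a′
    fb : Fixed m b
    fb = fixed-+ m fa fa′
    v = (y + b) ⁻¹
    w = a * a′ * (v * v)
    x = t₁ * conj t₂
    x̄ = conj t₁ * t₂
    r = x * w
    y≈ : y ≈ a * t₁ + a′ * t₂
    y≈ = x+y≈0⇒x≈y (trans (sym (+-assoc _ _ _)) eq)
    conj-y : y ≈ a * conj t₁ + a′ * conj t₂
    conj-y = trans (sym fy) (trans (F-cong n y≈) (trans (F-+ n _ _) (+-cong
      (trans (F-* n a t₁) (*-congʳ (sub fa))) (trans (F-* n a′ t₂) (*-congʳ (sub fa′))))))
    sum-sq : (y + b) * (y + b) ≈ a * a′ * (x + x̄)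
    sum-sq = begin
      (y + b) * (y + b)
        ≈⟨ solve 2 (λ y b → (y :+ b) :* (y :+ b) := y :* y :+ b :* b) refl y b ⟩
      y * y + b * b
        ≈⟨ +-congʳ (*-cong y≈ conj-y) ⟩
      (a * t₁ + a′ * t₂) * (a * conj t₁ + a′ * conj t₂) + b * b
        ≈⟨ by₂ (a * a) (a′ * a′) Ht₁ Ht₂ (solve 6 (λ a a′ t₁ t₂ s₁ s₂ →
             ((a :* t₁ :+ a′ :* t₂) :* (a :* s₁ :+ a′ :* s₂) :+ (a :+ a′) :* (a :+ a′))
               :+ a :* a′ :* (t₁ :* s₂ :+ s₁ :* t₂)
             := a :* a :* (t₁ :* s₁ :+ :1) :+ a′ :* a′ :* (t₂ :* s₂ :+ :1))
             refl a a′ t₁ t₂ (conj t₁) (conj t₂)) ⟩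
      a * a′ * (x + x̄) ∎
    w[x+x̄]≈1 : w * (x + x̄) ≈ 1#
    w[x+x̄]≈1 = by₂ (v * v) (v * (y + b) + 1#) sum-sq (v*[y+b] fy ¬fy fb)
      (solve 6 (λ a a′ y v x x̄ → a :* a′ :* (v :* v) :* (x :+ x̄) :+ :1
         := v :* v :* ((y :+ (a :+ a′)) :* (y :+ (a :+ a′)) :+ a :* a′ :* (x :+ x̄))
            :+ (v :* (y :+ (a :+ a′)) :+ :1) :* (v :* (y :+ (a :+ a′)) :+ :1)) refl a a′ y v x x̄)
    fw : Fixed n w
    fw = fixed-* n (fixed-* n (sub fa) (sub fa′))
      (fixed-* n (fixed-v fy ¬fy fb) (fixed-v fy ¬fy fb))
    conj-r : conj r ≈ x̄ * w
    conj-r = trans (F-* n x w) (*-cong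
      (trans (F-* n t₁ _) (*-congˡ (conj-involutive t₂))) fw)
    xx̄≈1 : x * x̄ ≈ 1#
    xx̄≈1 = by₂ (t₂ * conj t₂) 1# Ht₁ Ht₂ (solve 4 (λ t₁ t₂ s₁ s₂ →
      t₁ :* s₂ :* (s₁ :* t₂) :+ :1
        := t₂ :* s₂ :* (t₁ :* s₁ :+ :1) :+ :1 :* (t₂ :* s₂ :+ :1)) refl t₁ t₂ (conj t₁) (conj t₂))
    r-eq : r * r + r ≈ w * w
    r-eq = by₂ (x * w) (w * w) w[x+x̄]≈1 xx̄≈1 (solve 3 (λ x x̄ w →
      (x :* w :* (x :* w) :+ x :* w) :+ w :* w
        := x :* w :* (w :* (x :+ x̄) :+ :1) :+ w :* w :* (x :* x̄ :+ :1)) refl x x̄ w)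
    τw≈1 : τ w ≈ 1#
    τw≈1 = begin
      τ w             ≈⟨ τ-sq fw ⟨
      τ (w * w)       ≈⟨ T-cong 1 n r-eq ⟨
      τ (r * r + r)   ≈⟨ τ-artin-schreier r ⟩
      conj r + r      ≈⟨ +-congʳ conj-r ⟩
      x̄ * w + x * w   ≈⟨ solve 3 (λ x x̄ w → x̄ :* w :+ x :* w := w :* (x :+ x̄)) refl x x̄ w ⟩
      w * (x + x̄)     ≈⟨ w[x+x̄]≈1 ⟩
      1#              ∎

  -- Syndromes that need one, two or three terms.

  subfield-rep₁ : ∀ {y} → Fixed m y → Rep 1 y
  subfield-rep₁ {y} fy = y , 1# , fy , H-1# , lift (trans (+-congˡ (*-identityʳ y)) (x+x≈0 y))

  -- Norms turn y = a t into y² = a², and square roots are unique in characteristic 2.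
  rep₁⇒subfield : ∀ {y} → Fixed n y → Rep 1 y → Fixed m y
  rep₁⇒subfield {y} fy (a , t , fa , Ht , lift eq) = fixed-cong m (sq-injective (begin
    a * a                         ≈⟨ *-identityʳ _ ⟨
    a * a * 1#                    ≈⟨ *-congˡ Ht ⟨
    a * a * (t * conj t)          ≈⟨ *-interchange a a _ _ ⟩
    a * t * (a * conj t)          ≈⟨ *-congˡ (*-congʳ (sub fa)) ⟨
    a * t * (conj a * conj t)     ≈⟨ *-congˡ (F-* n a t) ⟨
    norm (a * t)                  ≈⟨ *-cong (x+y≈0⇒x≈y eq) (F-cong n (x+y≈0⇒x≈y eq)) ⟨
    norm y                        ≈⟨ norm-fixed-sq fy ⟩
    y * y                         ∎)) fa

  m<n : m < n
  m<n = ℕ.<-≤-trans (ℕ.m<m+n m 1≤m) (ℕ.≤-trans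
    (ℕ.≤-reflexive (k+k≡k*2 m)) (ℕ.*-monoʳ-≤ m 2≤s))

  -- x + x^q always lies in 𝔽_q; if it always lay in 𝔽_{q₀}, then all q² elements of K would be
  -- roots of a polynomial of degree q₀ q.
  outside-subfield : ∃[ y ] Fixed n y × ¬ Fixed m y
  outside-subfield =
    let x , fx≉0 = nonroot d
          (poly-cong d (trans (+-congˡ (trans (+-identityˡ _) (+-identityʳ 0#))) (+-identityʳ 1#))
            (poly-+ d (poly-pow d)
              (poly-+ d (lower (ℕ.m<m+n m 1≤n))
                (poly-+ d (lower (ℕ.m<n+m n 1≤m)) (lower (ℕ.<-≤-trans 1≤m (ℕ.m≤m+n m n)))))))
          1≉0
          (≡.subst (d <_) (≡.sym card≡) (ℕ.^-monoʳ-< 2 (s≤s (s≤s z≤n))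
            (ℕ.<-≤-trans (ℕ.+-monoˡ-< n m<n) (ℕ.≤-reflexive (k+k≡k*2 n)))))
    in x + conj x ,
       trans (F-+ n x _) (trans (+-congˡ (conj-involutive x)) (+-comm _ _)) ,
       λ fixed → fx≉0 (begin
         F (m ℕ.+ n) x + (F m x + (F n x + F 0 x))
           ≈⟨ +-cong (F-∘ m n x) (+-congˡ (+-congˡ (F-zero x))) ⟩
         F m (F n x) + (F m x + (F n x + x))
           ≈⟨ solve 4 (λ a b c d → a :+ (b :+ (c :+ d)) := (b :+ a) :+ (d :+ c)) refl _ _ _ _ ⟩
         (F m x + F m (F n x)) + (x + F n x)       ≈⟨ +-congʳ (F-+ m x _) ⟨
         F m (x + F n x) + (x + F n x)             ≈⟨ x≈y⇒x+y≈0 fixed ⟩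
         0#                                        ∎)
    where
    d : ℕ
    d = 2 ^ (m ℕ.+ n)
    lower : ∀ {k l} → k < l → IsPoly (2 ^ l) 0# (F k)
    lower {k} k<l = poly-raise-< (ℕ.^-monoʳ-< 2 (s≤s (s≤s z≤n)) k<l) (poly-pow (2 ^ k))

  -- Searching the enumeration decides existence, which keeps the case distinctions and the argument
  -- by contradiction below constructive.
  ∃? : ∀ {p} {P : Carrier → Set p} → (∀ x → Dec (P x)) → (∀ {x y} → x ≈ y → P x → P y) → Dec (∃ P)
  ∃? P? resp = map′ (λ any → let x , _ , Px = find setoid any in x , Px)
    (λ (x , Px) → lose setoid resp (complete x) Px) (Any.any? P? elems)

  -- The syndromes y ∈ 𝔽_q that are not sums of two terms.
  Bad : Carrier → Set (c ⊔ ℓ)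
  Bad y = Fixed n y × ¬ Fixed m y × (∀ b → Fixed m b → Tr₀ (g y b) ≈ 0#)

  -- The bad element is the factor y of z = h y. The type forgets this, as only the existence of a
  -- bad element separates the two radii.
  rep₂-or-bad : ∀ z → Rep 2 z ⊎ ∃ Bad
  rep₂-or-bad z with z ≟ 0#
  ... | yes z≈0 = inj₁ (rep-mono {0} {2} z≤n (lift z≈0))
  ... | no  z≉0 = from-polar (polar z z≉0)
    where
    from-polar : ∃[ y ] ∃[ h ] Fixed n y × H h × ¬ y ≈ 0# × z ≈ h * y → Rep 2 z ⊎ ∃ Bad
    from-polar (y , h , fy , Hh , y≉0 , z≈hy) with F m y ≟ y
    ... | yes fmy = inj₁ (rep-cong 2 (sym z≈hy) (rep-scale 2 Hh (rep-suc 1 (subfield-rep₁ fmy))))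
    ... | no ¬fmy with ∃? {P = λ b → Fixed m b × ¬ Tr₀ (g y b) ≈ 0#}
                          (λ b → (F m b ≟ b) ×-dec ¬? (Tr₀ (g y b) ≟ 0#))
                          (λ {b} {b′} b≈b′ (fb , ≉0) → fixed-cong m b≈b′ fb ,
                             λ ≈0 → ≉0 (trans (T-cong m s (g-cong fy ¬fmy fb b≈b′)) ≈0))
    ... | yes (b , fb , ≉0) = inj₁ (rep-cong 2 (sym z≈hy)
                                (rep-scale 2 Hh (nonzero-trace⇒rep₂ fy ¬fmy fb ≉0)))
    ... | no ¬∃ = inj₂ (y , fy , ¬fmy , λ b fb →
                    decidable-stable (Tr₀ (g y b) ≟ 0#) λ ≉0 → ¬∃ (b , fb , ≉0))

  bad⇒¬rep₂ : ∀ {y} → Bad y → ¬ Rep 2 y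
  bad⇒¬rep₂ (fy , ¬fy , all0) rep =
    let b , fb , ≉0 = rep₂⇒nonzero-trace fy ¬fy rep in ≉0 (all0 b fb)

  -- The w ∈ 𝔽_q with τ w = 1 are the reciprocals of the values t + t⁻¹ ≠ 0 with t ∈ H, and then
  -- φ w = y² + 1 + y/w is the norm of y + t. If φ w is never of the form t′ + t′⁻¹, the norm of
  -- 1 + t′, then w ↦ 1/w (for τ w = 1), w ↦ φ (w + w₀) (for τ w = 0) is an injection of 𝔽_q into
  -- itself that misses 0.
  module _ {y} (fy : Fixed n y) (¬fy : ¬ Fixed m y) where
    private
      φ : Carrier → Carrier
      φ w = y * y + 1# + y * w ⁻¹

      fixed-φ : ∀ {w} → Fixed n w → τ w ≈ 1# → Fixed n (φ w)
      fixed-φ fw τw≈1 = fixed-+ n (fixed-+ n (fixed-* n fy fy) (F-1# n))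
        (fixed-* n fy (fixed-⁻¹ n (τ≈1⇒≉0 τw≈1) fw))

      y≉0 : ¬ y ≈ 0#
      y≉0 = outside⇒≉0 ¬fy

      -- If φ w = 0, then w = y / (y + 1)² = e² + e with e = 1 / (y + 1) in 𝔽_q, and such an element
      -- has absolute trace 0.
      φ≉0 : ∀ {w} → τ w ≈ 1# → ¬ φ w ≈ 0#
      φ≉0 {w} τw≈1 φw≈0 = 1≉0 (begin
        1#                ≈⟨ τw≈1 ⟨
        τ w               ≈⟨ T-cong 1 n w≈ ⟩
        τ (e * e + e)     ≈⟨ τ-artin-schreier e ⟩
        conj e + e        ≈⟨ x≈y⇒x+y≈0 (fixed-v fy ¬fy (F-1# m)) ⟩
        0#                ∎)
        where
        e i : Carrier
        e = (y + 1#) ⁻¹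
        i = w ⁻¹
        w≈ : w ≈ e * e + e
        w≈ = begin
          w
            ≈⟨ by₂ w (e * (y + 1#) * w + w) refl (v*[y+b] fy ¬fy (F-1# m))
            (solve 3 (λ e y w → w :+ e :* e :* (y :+ :1) :* (y :+ :1) :* w
               := w :* (w :+ w) :+ (e :* (y :+ :1) :* w :+ w) :* (e :* (y :+ :1) :+ :1)) refl e y w) ⟩
          e * e * (y + 1#) * (y + 1#) * w
            ≈⟨ by₂ (e * e * w) (e * e * y) φw≈0 (inverseʳ w (τ≈1⇒≉0 τw≈1))
            (solve 4 (λ e y w i → e :* e :* (y :+ :1) :* (y :+ :1) :* w :+ e :* e :* y
               := e :* e :* w :* ((y :* y :+ :1 :+ y :* i) :+ :0)
                  :+ e :* e :* y :* (w :* i :+ :1)) refl e y w i) ⟩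
          e * e * y                        ≈⟨ by₁ e (v*[y+b] fy ¬fy (F-1# m))
            (solve 2 (λ e y → e :* e :* y :+ (e :* e :+ e) := e :* (e :* (y :+ :1) :+ :1)) refl e y) ⟩
          e * e + e                        ∎

      Solution : Carrier → Set ℓ
      Solution w = Fixed n w × τ w ≈ 1# × τ (φ w ⁻¹) ≈ 1#

      -- Both y + t and 1 + t′ have norm φ w, so y = t + h (1 + t′) with `h` in `H`: three terms
      -- with coefficient 1.
      solution⇒rep₃ : ∃ Solution → Rep 3 y
      solution⇒rep₃ (w , fw , τw≈1 , τ′≈1) =
        let t , Ht , tw = circle-point fw τw≈1
            t′ , Ht′ , t′w = circle-point (fixed-⁻¹ n (φ≉0 τw≈1) (fixed-φ fw τw≈1)) τ′≈1
            w≉0 = τ≈1⇒≉0 τw≈1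
            norm-y+t : norm (y + 1# * t) ≈ φ w
            norm-y+t = begin
              norm (y + 1# * t)
                ≈⟨ *-congˡ (trans (F-+ n y _) (+-cong fy (F-cong n (*-identityˡ t)))) ⟩
              (y + 1# * t) * (y + conj t) ≈⟨ by₂ y 1# (inverse-unique w≉0 (trans (*-comm _ _) tw)) Ht
                (solve 4 (λ y t t̄ i → (y :+ :1 :* t) :* (y :+ t̄) :+ (y :* y :+ :1 :+ y :* i)
                   := y :* ((t :+ t̄) :+ i) :+ :1 :* (t :* t̄ :+ :1)) refl y t (conj t) (w ⁻¹)) ⟩
              φ w                         ∎
            norm-1+t′ : norm (1# + t′) ≈ φ w
            norm-1+t′ = begin
              norm (1# + t′)              ≈⟨ *-congˡ (trans (F-+ n 1# t′) (+-congʳ (F-1# n))) ⟩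
              (1# + t′) * (1# + conj t′)  ≈⟨ by₁ 1# Ht′ (solve 2 (λ t t̄ →
                (:1 :+ t) :* (:1 :+ t̄) :+ (t :+ t̄) := :1 :* (t :* t̄ :+ :1)) refl t′ (conj t′)) ⟩
              t′ + conj t′
                ≈⟨ inverse-unique (⁻¹-≉0 (φ≉0 τw≈1)) (trans (*-comm _ _) t′w) ⟩
              (φ w ⁻¹) ⁻¹                 ≈⟨ ⁻¹-involutive (φ≉0 τw≈1) ⟩
              φ w                         ∎
            h , Hh , y+t≈ = equal-norms (trans norm-y+t (sym norm-1+t′))
              (≉0-of-norm (λ e → φ≉0 τw≈1 (trans (sym norm-1+t′) e)))
            rep : Rep 2 (1# + t′)
            rep = 1# , 1# , F-1# m , H-1# , 1# , t′ , F-1# m , Ht′ , lift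
              (solve 1 (λ t → (:1 :+ t) :+ :1 :* :1 :+ :1 :* t := :0) refl t′)
        in 1# , t , F-1# m , Ht , rep-cong 2 (sym y+t≈) (rep-scale 2 Hh rep)

      solution? : Dec (∃ Solution)
      solution? = ∃? (λ w → (F n w ≟ w) ×-dec (τ w ≟ 1#) ×-dec (τ (φ w ⁻¹) ≟ 1#))
        λ w≈w′ (fw , τw≈1 , τ′≈1) →
          fixed-cong n w≈w′ fw ,
          trans (T-cong 1 n (sym w≈w′)) τw≈1 ,
          trans (T-cong 1 n (sym (⁻¹-cong (φ≉0 τw≈1)
            (+-congˡ (*-congˡ (⁻¹-cong (τ≈1⇒≉0 τw≈1) w≈w′)))))) τ′≈1

      -- A graph instead of a function: each value remembers its branch, which the injectivity proof
      -- inspects. The identity outside 𝔽_q extends the map to all of `K`, where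
      -- `injective⇒surjective` applies.
      data Image (w : Carrier) : Carrier → Set (c ⊔ ℓ) where
        outside : ¬ Fixed n w → Image w w
        value   : Fixed n w → τ w ≈ 1# → Image w (w ⁻¹)
        shifted : Fixed n (w + w₀) → τ (w + w₀) ≈ 1# → Image w (φ (w + w₀))

      image : ∀ w → ∃ (Image w)
      image w with F n w ≟ w
      ... | no ¬fw = w , outside ¬fw
      ... | yes fw with T₁-value n fw
      ... | inj₂ τw≈1 = w ⁻¹ , value fw τw≈1
      ... | inj₁ τw≈0 = φ (w + w₀) , shifted (fixed-+ n fw fixed-w₀)
        (trans (T-+ 1 n w w₀) (trans (+-cong τw≈0 τw₀≈1) (+-identityˡ 1#)))

      ⁻¹-injective : ∀ {x z} → ¬ x ≈ 0# → ¬ z ≈ 0# → x ⁻¹ ≈ z ⁻¹ → x ≈ z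
      ⁻¹-injective x≉0 z≉0 eq =
        trans (sym (⁻¹-involutive x≉0)) (trans (⁻¹-cong (⁻¹-≉0 x≉0) eq) (⁻¹-involutive z≉0))

      -- The one place where the absence of solutions enters: equality would make 1 / φ w′ equal to
      -- `w`, which has trace 1.
      value≉shifted : ¬ ∃ Solution → ∀ {w w′} → Fixed n w → τ w ≈ 1# → Fixed n w′ → τ w′ ≈ 1# →
                      ¬ w ⁻¹ ≈ φ w′
      value≉shifted ¬solution {w} {w′} fw τw≈1 fw′ τw′≈1 eq = ¬solution (w′ , fw′ , τw′≈1 ,
        trans (T-cong 1 n (trans (⁻¹-cong (φ≉0 τw′≈1) (sym eq)) (⁻¹-involutive (τ≈1⇒≉0 τw≈1)))) τw≈1)

      image-injective : ¬ ∃ Solution → ∀ {w w′ x x′} → Image w x → Image w′ x′ → x ≈ x′ → w ≈ w′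
      image-injective ¬sol (outside _)    (outside _)     eq = eq
      image-injective ¬sol (outside ¬f)   (value f′ τ′)   eq =
        contradiction (fixed-cong n (sym eq) (fixed-⁻¹ n (τ≈1⇒≉0 τ′) f′)) ¬f
      image-injective ¬sol (outside ¬f)   (shifted f′ τ′) eq =
        contradiction (fixed-cong n (sym eq) (fixed-φ f′ τ′)) ¬f
      image-injective ¬sol (value f τ₁)   (outside ¬f)    eq =
        contradiction (fixed-cong n eq (fixed-⁻¹ n (τ≈1⇒≉0 τ₁) f)) ¬f
      image-injective ¬sol (value _ τ₁)   (value _ τ′)    eq =
        ⁻¹-injective (τ≈1⇒≉0 τ₁) (τ≈1⇒≉0 τ′) eq
      image-injective ¬sol (value f τ₁)   (shifted f′ τ′) eq =
        contradiction eq (value≉shifted ¬sol f τ₁ f′ τ′)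
      image-injective ¬sol (shifted f τ₁) (outside ¬f)    eq =
        contradiction (fixed-cong n eq (fixed-φ f τ₁)) ¬f
      image-injective ¬sol (shifted f τ₁) (value f′ τ′)   eq =
        contradiction (sym eq) (value≉shifted ¬sol f′ τ′ f τ₁)
      image-injective ¬sol (shifted _ τ₁) (shifted _ τ′)  eq =
        +-cancelʳ w₀ _ _ (⁻¹-injective (τ≈1⇒≉0 τ₁) (τ≈1⇒≉0 τ′) (*-cancelˡ y≉0 (+-cancelˡ _ _ _ eq)))

      image≉0 : ∀ {w x} → Image w x → ¬ x ≈ 0#
      image≉0 (outside ¬fw)    x≈0 = ¬fw (fixed-cong n (sym x≈0) (F-0# n))
      image≉0 (value _ τw≈1)   = ⁻¹-≉0 (τ≈1⇒≉0 τw≈1)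
      image≉0 (shifted _ τw≈1) = φ≉0 τw≈1

      ¬¬solution : ¬ ¬ ∃ Solution
      ¬¬solution ¬solution =
        let w , 0≈ = injective⇒surjective (λ w → proj₁ (image w))
                       (λ {w} {w′} → image-injective ¬solution (proj₂ (image w)) (proj₂ (image w′))) 0#
        in image≉0 (proj₂ (image w)) (sym 0≈)

    rep₃ : Rep 3 y
    rep₃ = solution⇒rep₃ (decidable-stable solution? ¬¬solution)

  rep₃-all : ∀ z → Rep 3 z
  rep₃-all z with rep₂-or-bad z
  ... | inj₁ rep = rep-suc 2 rep
  -- The type does not tie the bad element to `z`, so `z` is decomposed again.
  ... | inj₂ _ with z ≟ 0#
  ... | yes z≈0 = rep-mono {0} {3} z≤n (lift z≈0)
  ... | no  z≉0 =
    let y , h , fy , Hh , _ , z≈hy = polar z z≉0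
    in rep-cong 3 (sym z≈hy) (rep-scale 3 Hh (in-subfield? y fy))
    where
    in-subfield? : ∀ y → Fixed n y → Rep 3 y
    in-subfield? y fy with F m y ≟ y
    ... | yes fmy = rep-mono {1} {3} (s≤s z≤n) (subfield-rep₁ fmy)
    ... | no ¬fmy = rep₃ fy ¬fmy

  -- From bad syndromes to the condition on α.

  module _ {y α} (fy : Fixed n y) (¬fy : ¬ Fixed m y) (αy≈1 : α * y ≈ 1#) where
    -- At b = 0 the factor `b` in `trace-g` hides the trace; here g y 0 = 1 / y = α gives condition
    -- (1) directly.
    trace-g₀ : Tr₀ (g y 0#) ≈ Tr₀ α
    trace-g₀ = T-cong m s (trans (+-congˡ (zeroˡ _)) (trans (+-identityʳ _)
      (sym (inverse-unique (y+b≉0 fy ¬fy (F-0# m))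
        (trans (*-comm _ _) (trans (*-congˡ (+-identityʳ y)) αy≈1))))))

    -- With β = 1/(1 + b α), the summands of g y b satisfy b/(y + b) = 1 + β.
    trace-g : ∀ {b} → Fixed m b →
      b * Tr₀ (g y b) ≈ Tr₀ ((1# + b * α) ⁻¹) * Tr₀ ((1# + b * α) ⁻¹) + Tr₀ ((1# + b * α) ⁻¹)
    trace-g {b} fb = begin
      b * Tr₀ (g y b)                       ≈⟨ T-scale m s _ fb ⟨
      Tr₀ (b * g y b)                       ≈⟨ T-cong m s (by₁
        (b * v + (1# + β) + 1#) bv≈ (solve 3 (λ b v β →
        b :* (v :+ b :* (v :* v)) :+ ((:1 :+ β) :* (:1 :+ β) :+ (:1 :+ β))
          := (b :* v :+ (:1 :+ β) :+ :1) :* (b :* v :+ (:1 :+ β))) refl b v β)) ⟩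
      Tr₀ ((1# + β) * (1# + β) + (1# + β))  ≈⟨ T-cong m s (solve 1 (λ β →
        (:1 :+ β) :* (:1 :+ β) :+ (:1 :+ β) := β :* β :+ β) refl β) ⟩
      Tr₀ (β * β + β)                       ≈⟨ T-+ m s _ _ ⟩
      Tr₀ (β * β) + Tr₀ β                   ≈⟨ +-congʳ (T-sq m s β) ⟩
      Tr₀ β * Tr₀ β + Tr₀ β                 ∎
      where
      v β : Carrier
      v = (y + b) ⁻¹
      β = (1# + b * α) ⁻¹
      1+bα≉0 : ¬ 1# + b * α ≈ 0#
      1+bα≉0 1+bα≈0 = y+b≉0 fy ¬fy fb (by₂ y b 1+bα≈0 αy≈1 (solve 3 (λ y b α →
        (y :+ b) :+ :0 := y :* ((:1 :+ b :* α) :+ :0) :+ b :* (α :* y :+ :1)) refl y b α))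
      bv≈ : b * v ≈ 1# + β
      bv≈ = *-cancelˡ (*-≉0 1+bα≉0 (y+b≉0 fy ¬fy fb)) (begin
        (1# + b * α) * (y + b) * (b * v)    ≈⟨ by₁ (b * (1# + b * α)) (v*[y+b] fy ¬fy fb)
          (solve 4 (λ y b α v → (:1 :+ b :* α) :* (y :+ b) :* (b :* v) :+ b :* (:1 :+ b :* α)
             := b :* (:1 :+ b :* α) :* (v :* (y :+ b) :+ :1)) refl y b α v) ⟩
        b * (1# + b * α)                    ≈⟨ by₁ b αy≈1
          (solve 3 (λ y b α → b :* (:1 :+ b :* α) :+ ((:1 :+ b :* α) :* (y :+ b) :+ (y :+ b))
             := b :* (α :* y :+ :1)) refl y b α) ⟩
        (1# + b * α) * (y + b) + (y + b)    ≈⟨ by₁ (y + b) (inverseˡ 1+bα≉0)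
          (solve 4 (λ y b α β →
             ((:1 :+ b :* α) :* (y :+ b) :+ (y :+ b)) :+ (:1 :+ b :* α) :* (y :+ b) :* (:1 :+ β)
             := (y :+ b) :* (β :* (:1 :+ b :* α) :+ :1)) refl y b α β) ⟩
        (1# + b * α) * (y + b) * (1# + β)   ∎)

  private
    2^m^≡ : ∀ k → (2 ^ m) ^ k ≡ 2 ^ (m ℕ.* k)
    2^m^≡ = ℕ.^-*-assoc 2 m

    InSub⇒Fixed : ∀ {x} → InSub K ((2 ^ m) ^ s) x → Fixed n x
    InSub⇒Fixed {x} = ≡.subst (λ k → x ^^ k ≈ x) (2^m^≡ s)

    Fixed⇒InSub : ∀ {x} → Fixed n x → InSub K ((2 ^ m) ^ s) x
    Fixed⇒InSub {x} = ≡.subst (λ k → x ^^ k ≈ x) (≡.sym (2^m^≡ s))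

    Tr≡T : ∀ k x → Tr K (2 ^ m) k x ≡ T m k x
    Tr≡T zero    x = ≡.refl
    Tr≡T (suc k) x = ≡.cong₂ _+_ (Tr≡T k x) (≡.cong (x ^^_) (2^m^≡ k))

  bad⇒cond : ∃ Bad → Cond K (2 ^ m) s
  bad⇒cond (y , fy , ¬fy , all0) = y ⁻¹ , Fixed⇒InSub (fixed-⁻¹ n y≉0 fy) ,
    (λ fα → ¬fy (fixed-cong m (⁻¹-involutive y≉0) (fixed-⁻¹ m (⁻¹-≉0 y≉0) fα))) ,
    ≡.subst (_≈ 0#) (≡.sym (Tr≡T s _))
      (trans (sym (trace-g₀ fy ¬fy (inverseˡ y≉0))) (all0 0# (F-0# m))) ,
    λ b fb _ → ≡.subst (λ x → x ≈ 0# ⊎ x ≈ 1#) (≡.sym (Tr≡T s _))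
      (idempotent⇒0∨1 (trans (sym (trace-g fy ¬fy (inverseˡ y≉0) fb))
        (trans (*-congˡ (all0 b fb)) (zeroʳ b))))
    where
    y≉0 : ¬ y ≈ 0#
    y≉0 = outside⇒≉0 ¬fy

  cond⇒bad : Cond K (2 ^ m) s → ∃ Bad
  cond⇒bad (α , fα , ¬fα , Trα≈0 , cond) = y , fy , ¬fy , all0
    where
    α≉0 : ¬ α ≈ 0#
    α≉0 = outside⇒≉0 ¬fα
    y : Carrier
    y = α ⁻¹
    fy : Fixed n y
    fy = fixed-⁻¹ n α≉0 (InSub⇒Fixed fα)
    ¬fy : ¬ Fixed m y
    ¬fy fy = ¬fα (fixed-cong m (⁻¹-involutive α≉0) (fixed-⁻¹ m (⁻¹-≉0 α≉0) fy))
    0∨1⇒idempotent : ∀ {x} → x ≈ 0# ⊎ x ≈ 1# → x * x + x ≈ 0#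
    0∨1⇒idempotent (inj₁ x≈0) = trans (+-cong (trans (*-congʳ x≈0) (zeroˡ _)) x≈0) (+-identityʳ 0#)
    0∨1⇒idempotent (inj₂ x≈1) = trans (+-congʳ (trans (*-congˡ x≈1) (*-identityʳ _))) (x+x≈0 _)
    all0 : ∀ b → Fixed m b → Tr₀ (g y b) ≈ 0#
    all0 b fb with b ≟ 0#
    ... | yes b≈0 = trans (T-cong m s (g-cong fy ¬fy fb b≈0))
                      (trans (trace-g₀ fy ¬fy (inverseʳ α α≉0)) (≡.subst (_≈ 0#) (Tr≡T s α) Trα≈0))
    ... | no b≉0 = *-cancelˡ b≉0 (trans (trace-g fy ¬fy (inverseʳ α α≉0) fb)
                     (trans (0∨1⇒idempotent (≡.subst (λ x → x ≈ 0# ⊎ x ≈ 1#) (Tr≡T s _) (cond b fb b≉0)))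
                            (sym (zeroʳ b))))

  covering-radius : (CoveringRadiusIs K (2 ^ m) ((2 ^ m) ^ s) 3 ⇔ Cond K (2 ^ m) s) ×
                    (¬ Cond K (2 ^ m) s → CoveringRadiusIs K (2 ^ m) ((2 ^ m) ^ s) 2)
  -- The proof works with q = 2^(m s), for which the q-th power is `F n`; the result is transported
  -- to (2^m)^s here.
  covering-radius = ≡.subst
    (λ q → (CoveringRadiusIs K (2 ^ m) q 3 ⇔ Cond K (2 ^ m) s) ×
           (¬ Cond K (2 ^ m) s → CoveringRadiusIs K (2 ^ m) q 2))
    (≡.sym (2^m^≡ s))
    ( mk⇔
        (λ radius → let z , ¬rep = coveringRadius⇒¬rep 2 radius
                    in bad⇒cond ([ (λ rep → contradiction rep ¬rep) , id ]′ (rep₂-or-bad z)))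
        (λ cond → let y , bad = cond⇒bad cond in coveringRadius 2 rep₃-all (y , bad⇒¬rep₂ bad))
    , λ ¬cond → coveringRadius 1
        (λ z → [ id , (λ bad → contradiction (bad⇒cond bad) ¬cond) ]′ (rep₂-or-bad z))
        (let y , fy , ¬fy = outside-subfield in y , λ rep → ¬fy (rep₁⇒subfield fy rep)) )

open import Data.Nat using (_*_)

mainTheorem2 : ∀ {c ℓ : Level} (K : FiniteField c ℓ) (m s : ℕ) →
    1 ≤ m → 2 ≤ s → FiniteField.card K ≡ (2 ^ m) ^ (2 * s) →
    (CoveringRadiusIs K (2 ^ m) ((2 ^ m) ^ s) 3 ⇔ Cond K (2 ^ m) s) ×
    (¬ Cond K (2 ^ m) s → CoveringRadiusIs K (2 ^ m) ((2 ^ m) ^ s) 2)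
mainTheorem2 K m s 1≤m 2≤s card≡ = Covering.covering-radius K 1+1≈0 m s 1≤m 2≤s card≡2^
  where
  open FieldFacts K using (_·1; card·1≈0; 2^n·1≈0⇒char2)
  card≡2^ : FiniteField.card K ≡ 2 ^ (m * s * 2)
  card≡2^ = ≡.trans card≡ (≡.trans (ℕ.^-*-assoc 2 m (2 * s))
    (≡.cong (2 ^_) (≡.trans (≡.cong (m *_) (ℕ.*-comm 2 s)) (≡.sym (ℕ.*-assoc m s 2)))))
  -- The cardinality times 1 is 0, and the cardinality is a power of 2.
  1+1≈0 : Characteristic2 K
  1+1≈0 = 2^n·1≈0⇒char2 (m * s * 2)
    (≡.subst (λ k → FiniteField._≈_ K (k ·1) (FiniteField.0# K)) card≡2^ card·1≈0)
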